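{- Let $T$ be a regular tournament of order $n-1$ such that $H_\omega(T)$ has exactly $3$ distinct eigenvalues. Then there exists a skew-Hadamard matrix of order $n$.
   Context: A tournament is an oriented graph whose underlying graph is complete; it is regular if all in-degrees and out-degrees of all vertices are equal. A Hadamard matrix of order $n$ is an $n\times n$ matrix $A$ with entries in $\{1,-1\}$ with $AA^\intercal=nI$; it is skew-Hadamard if moreover $A-I$ is skew-symmetric. Let $\omega=\frac{1+i\sqrt3}{2}$. The Hermitian adjacency matrix $H_\omega(T)$ has $(u,v)$-entry $\omega$ if $u\to v$, $\overline{\omega}$ if $v\to u$, and $0$ otherwise. -}

module Defs where

open import Level using (Level; _⊔_)
open import Data.Bool using (Bool; true; false; not; if_then_else_)
open import Data.Nat as ℕ using (ℕ; zero; suc)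
open import Data.Integer as ℤ using (ℤ; +_)
open import Data.Fin using (Fin; zero; suc)
open import Data.Fin.Properties using (_≟_)
open import Data.List using (List; []; _∷_; _++_)
open import Data.Product using (Σ; ∃; _×_; _,_)
open import Data.Sum using (_⊎_)
open import Relation.Nullary using (¬_; does)
open import Relation.Binary.PropositionalEquality using (_≡_; _≢_)
open import Algebra.Bundles using (CommutativeRing)

record Tournament (m : ℕ) : Set where
  field
    arc      : Fin m → Fin m → Bool
    irrefl   : ∀ u → arc u u ≡ false
    oriented : ∀ u v → u ≢ v → arc v u ≡ not (arc u v)

open Tournament public

sumℕ : (m : ℕ) → (Fin m → ℕ) → ℕ
sumℕ zero    f = 0
sumℕ (suc m) f = f zero ℕ.+ sumℕ m (λ i → f (suc i))

indicator : Bool → ℕ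
indicator true  = 1
indicator false = 0

outdeg : ∀ {m} → Tournament m → Fin m → ℕ
outdeg {m} T u = sumℕ m (λ v → indicator (arc T u v))

indeg : ∀ {m} → Tournament m → Fin m → ℕ
indeg {m} T v = sumℕ m (λ u → indicator (arc T u v))

Regular : ∀ {m} → Tournament m → Set
Regular {m} T = ∃ λ k → ∀ u → outdeg T u ≡ k × indeg T u ≡ k

sumℤ : (n : ℕ) → (Fin n → ℤ) → ℤ
sumℤ zero    f = + 0
sumℤ (suc n) f = f zero ℤ.+ sumℤ n (λ i → f (suc i))

δ : ∀ {n} → Fin n → Fin n → ℤ
δ i j = if does (i ≟ j) then + 1 else + 0

IsHadamard : (n : ℕ) → (Fin n → Fin n → ℤ) → Set
IsHadamard n A =
  (∀ i j → A i j ≡ + 1 ⊎ A i j ≡ ℤ.- (+ 1)) ×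
  (∀ i j → sumℤ n (λ k → A i k ℤ.* A j k) ≡ (+ n) ℤ.* δ i j)

IsSkewHadamard : (n : ℕ) → (Fin n → Fin n → ℤ) → Set
IsSkewHadamard n A =
  IsHadamard n A ×
  (∀ i j → A i j ℤ.- δ i j ≡ ℤ.- (A j i ℤ.- δ j i))

SkewHadamardExists : ℕ → Set
SkewHadamardExists n = Σ (Fin n → Fin n → ℤ) (IsSkewHadamard n)

-- Algebraically closed fields of characteristic 0 (stand-in for ℂ)

module _ {c ℓ : Level} (R : CommutativeRing c ℓ) where
  open CommutativeRing R using (Carrier; _≈_; _+_; _*_; 0#; 1#)

  natK : ℕ → Carrier
  natK zero    = 0#
  natK (suc n) = 1# + natK n

  evalPoly : List Carrier → Carrier → Carrier
  evalPoly []       x = 0#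
  evalPoly (a ∷ as) x = a + x * evalPoly as x

  record IsAlgClosedChar0Field : Set (c ⊔ ℓ) where
    field
      nontrivial : ¬ (1# ≈ 0#)
      inverse    : ∀ x → ¬ (x ≈ 0#) → ∃ λ y → x * y ≈ 1#
      char0      : ∀ n → ¬ (natK (suc n) ≈ 0#)
      algClosed  : ∀ (a : Carrier) (as : List Carrier) →
                   ∃ λ x → evalPoly ((a ∷ as) ++ (1# ∷ [])) x ≈ 0#

record ACField (c ℓ : Level) : Set (Level.suc (c ⊔ ℓ)) where
  field
    ring     : CommutativeRing c ℓ
    isACF    : IsAlgClosedChar0Field ring

module Spectrum {c ℓ : Level} (K : ACField c ℓ) where
  open ACField K
  open CommutativeRing ring using (Carrier; _≈_; _+_; _*_; _-_; 0#; 1#)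

  sumK : (m : ℕ) → (Fin m → Carrier) → Carrier
  sumK zero    f = 0#
  sumK (suc m) f = f zero + sumK m (λ i → f (suc i))

  -- ω is a root of x² - x + 1 (a primitive 6th root of unity); its conjugate is 1 - ω
  IsOmega : Carrier → Set ℓ
  IsOmega ω = (ω * ω) - ω + 1# ≈ 0#

  conj : Carrier → Carrier
  conj ω = 1# - ω

  Hω : Carrier → ∀ {m} → Tournament m → Fin m → Fin m → Carrier
  Hω ω T u v =
    if does (u ≟ v) then 0#
    else (if arc T u v then ω else conj ω)

  IsEigenvalue : Carrier → ∀ {m} → Tournament m → Carrier → Set (c ⊔ ℓ)
  IsEigenvalue ω {m} T λ′ =
    ∃ λ (x : Fin m → Carrier) →
      (∃ λ i → ¬ (x i ≈ 0#)) ×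
      (∀ u → sumK m (λ v → Hω ω T u v * x v) ≈ λ′ * x u)

  ExactlyThreeEigenvalues : Carrier → ∀ {m} → Tournament m → Set (c ⊔ ℓ)
  ExactlyThreeEigenvalues ω T =
    ∃ λ λ₁ → ∃ λ λ₂ → ∃ λ λ₃ →
      ¬ (λ₁ ≈ λ₂) × ¬ (λ₁ ≈ λ₃) × ¬ (λ₂ ≈ λ₃) ×
      IsEigenvalue ω T λ₁ × IsEigenvalue ω T λ₂ × IsEigenvalue ω T λ₃ ×
      (∀ μ → IsEigenvalue ω T μ → μ ≈ λ₁ ⊎ μ ≈ λ₂ ⊎ μ ≈ λ₃)

module Submission where

open import Defs
open import Level using (Level; _⊔_)
open import Data.Empty using (⊥-elim)
open import Data.Bool using (true; false; if_then_else_)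
open import Data.Nat as ℕ using (ℕ; zero; suc)
import Data.Nat.Properties as ℕₚ
open import Data.Nat.Divisibility using (_∣_; _∣?_; divides; n∣m*n; ∣m+n∣m⇒∣n; ∣⇒≤)
open import Data.Integer as ℤ using (ℤ; +_; -[1+_])
import Data.Integer.Properties as ℤₚ
open import Data.Integer.Solver using (module +-*-Solver)
open import Data.Fin using (Fin; zero; suc; punchIn; punchOut; toℕ)
open import Data.Fin.Properties using (_≟_; punchIn-punchOut)
open import Data.List using ([]; _∷_; _++_)
open import Data.Maybe using (Maybe; just; nothing)
open import Data.Product using (∃; _×_; _,_; proj₁; proj₂)
open import Data.Sum using (_⊎_; inj₁; inj₂)
open import Data.Vec using (Vec; []; _∷_; toList)
open import Data.Vec.Functional using (insertAt)
open import Data.Vec.Functional.Properties using (insertAt-lookup; insertAt-punchIn)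
open import Function using (_∘_)
open import Relation.Nullary using (¬_; yes; no)
open import Relation.Nullary.Decidable
  using (dec-true; dec-false; ¬¬-excluded-middle; decidable-stable; from-no)
open import Relation.Binary.PropositionalEquality as ≡ using (_≡_; _≢_)
import Relation.Binary.Reasoning.Setoid
open import Algebra.Bundles using (CommutativeRing)
open import Algebra.Solver.Ring.AlmostCommutativeRing
  using (fromCommutativeRing; _-Raw-AlmostCommutative⟶_)
import Algebra.Solver.Ring
import Algebra.Properties.Ring
import Algebra.Properties.AbelianGroup
import Algebra.Properties.Semiring.Sum
import Algebra.Properties.Semiring.Mult.TCOptimised

-- Let m be the order, S the ±1 skew matrix of T and s = 2ω - 1, so that
-- s² = -3 and 2 H + I - J = s S.  The bordered matrix [[1, 1], [-1, I + S]] is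
-- skew-Hadamard as soon as the integer matrix Q = S² + m I - J vanishes.
--
-- The degree (m - 1)/2 is an eigenvalue of H.  Since Hᵀ = J - I - H and a matrix
-- and its transpose have the same eigenvalues, the map h ↦ -1 - h permutes the
-- eigenvalues of H whose eigenvectors have zero sum; on such vectors
-- -3 S² = (2 H + I)².  If there are three eigenvalues, then on vectors of zero
-- sum either -3 S² has a single eigenvalue, or its eigenvalues lie in {0, m²}.
-- In the second case its trace 3m(m - 1) is a multiple of m², so m is 1 or 3 and
-- Q = 0 because Q is symmetric with zero diagonal and zero row sums.  In the
-- first case Q has a single eigenvalue c on vectors of zero sum; as tr Q = 0,
-- either c = 0 or m = 1.  If c = 0 then Q² has no eigenvalue but 0, so
-- the sum of the squares of the entries of Q is tr Q² = 0.
--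
-- The trace of an n × n matrix is a sum of n eigenvalues, by deflating along one
-- eigenvector at a time.  Equality in the field need not be decidable, so facts
-- about it are derived under a double negation, which the decidable integer
-- statement Q = 0 allows to be removed.

-- The double-negation monad

infixl 1 _>>=_

_>>=_ : ∀ {a b} {A : Set a} {B : Set b} → ¬ ¬ A → (A → ¬ ¬ B) → ¬ ¬ B
(m >>= f) k = m (λ a → f a k)

pure : ∀ {a} {A : Set a} → A → ¬ ¬ A
pure a k = k a

-- The integers inside a field of characteristic zero

module Field {c ℓ : Level} (K : ACField c ℓ) where
  open ACField K public using (isACF) renaming (ring to commutativeRing)
  open IsAlgClosedChar0Field isACF public
  open CommutativeRing commutativeRing public hiding (zero)
  open Algebra.Properties.Ring ring public
    using (-0#≈0#; -‿distribˡ-*; -‿distribʳ-*)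
  open Algebra.Properties.AbelianGroup +-abelianGroup public
    using (⁻¹-∙-comm; ⁻¹-involutive; x∙y⁻¹≈ε⇒x≈y; x≈y⇒x∙y⁻¹≈ε)
  open Algebra.Properties.Semiring.Sum semiring public
  open Relation.Binary.Reasoning.Setoid setoid public

  open Algebra.Properties.Semiring.Mult.TCOptimised semiring
    using (1+×; ×-homo-+; ×1-homo-*) renaming (_×_ to _×′_)

  -- The optimised multiple makes nat 1 reduce to 1#, so that the ring solver
  -- can denote 1# by the constant + 1.
  nat : ℕ → Carrier
  nat n = n ×′ 1#

  nat-suc : ∀ n → nat (suc n) ≈ 1# + nat n
  nat-suc n = 1+× n 1#

  nat≉0 : ∀ n → ¬ nat (suc n) ≈ 0#
  nat≉0 n e = char0 n (trans (natK≈nat (suc n)) e)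
    where
    natK≈nat : ∀ n → natK commutativeRing n ≈ nat n
    natK≈nat zero    = refl
    natK≈nat (suc n) = trans (+-congˡ (natK≈nat n)) (sym (1+× n 1#))

  ι : ℤ → Carrier
  ι (+ n)    = nat n
  ι -[1+ n ] = - nat (suc n)

  ι-⊖ : ∀ m n → ι (m ℤ.⊖ n) ≈ nat m - nat n
  ι-⊖ m zero = begin
    ι (m ℤ.⊖ 0)  ≡⟨ ≡.cong ι (ℤₚ.⊖-≥ {m} {0} ℕ.z≤n) ⟩
    nat m        ≈⟨ +-identityʳ _ ⟨
    nat m + 0#   ≈⟨ +-congˡ -0#≈0# ⟨
    nat m - 0#   ∎
  ι-⊖ zero (suc n) = sym (+-identityˡ _)
  ι-⊖ (suc m) (suc n) = begin
    ι (suc m ℤ.⊖ suc n)               ≡⟨ ≡.cong ι (ℤₚ.[1+m]⊖[1+n]≡m⊖n m n) ⟩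
    ι (m ℤ.⊖ n)                       ≈⟨ ι-⊖ m n ⟩
    nat m - nat n                     ≈⟨ +-identityˡ _ ⟨
    0# + (nat m - nat n)              ≈⟨ +-congʳ (-‿inverseʳ 1#) ⟨
    1# - 1# + (nat m - nat n)         ≈⟨ +-assoc _ _ _ ⟩
    1# + (- 1# + (nat m - nat n))     ≈⟨ +-congˡ (+-assoc _ _ _) ⟨
    1# + (- 1# + nat m - nat n)       ≈⟨ +-congˡ (+-congʳ (+-comm _ _)) ⟩
    1# + (nat m - 1# - nat n)         ≈⟨ +-congˡ (+-assoc _ _ _) ⟩
    1# + (nat m + (- 1# - nat n))     ≈⟨ +-congˡ (+-congˡ (⁻¹-∙-comm _ _)) ⟩
    1# + (nat m - (1# + nat n))       ≈⟨ +-assoc _ _ _ ⟨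
    1# + nat m - (1# + nat n)         ≈⟨ +-cong (1+× m 1#) (-‿cong (1+× n 1#)) ⟨
    nat (suc m) - nat (suc n)         ∎

  ι-+ : ∀ i j → ι (i ℤ.+ j) ≈ ι i + ι j
  ι-+ (+ m)    (+ n)    = ×-homo-+ 1# m n
  ι-+ (+ m)    -[1+ n ] = ι-⊖ m (suc n)
  ι-+ -[1+ m ] (+ n)    = trans (ι-⊖ n (suc m)) (+-comm _ _)
  ι-+ -[1+ m ] -[1+ n ] = begin
    - nat (suc (suc (m ℕ.+ n)))     ≡⟨ ≡.cong (-_ ∘ nat ∘ suc) (ℕₚ.+-suc m n) ⟨
    - nat (suc m ℕ.+ suc n)         ≈⟨ -‿cong (×-homo-+ 1# (suc m) (suc n)) ⟩
    - (nat (suc m) + nat (suc n))   ≈⟨ ⁻¹-∙-comm _ _ ⟨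
    - nat (suc m) - nat (suc n)     ∎

  ι-neg : ∀ i → ι (ℤ.- i) ≈ - ι i
  ι-neg (+ zero)  = sym -0#≈0#
  ι-neg (+ suc n) = refl
  ι-neg -[1+ n ]  = sym (⁻¹-involutive _)

  ι-*-nonNegˡ : ∀ m j → ι (+ m ℤ.* j) ≈ nat m * ι j
  ι-*-nonNegˡ m (+ n) = trans (reflexive (≡.cong ι (≡.sym (ℤₚ.pos-* m n)))) (×1-homo-* m n)
  ι-*-nonNegˡ m -[1+ n ] = begin
    ι (+ m ℤ.* ℤ.- (+ suc n))     ≡⟨ ≡.cong ι (ℤₚ.neg-distribʳ-* (+ m) (+ suc n)) ⟨
    ι (ℤ.- (+ m ℤ.* + suc n))     ≈⟨ ι-neg (+ m ℤ.* + suc n) ⟩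
    - ι (+ m ℤ.* + suc n)         ≡⟨ ≡.cong (-_ ∘ ι) (ℤₚ.pos-* m (suc n)) ⟨
    - nat (m ℕ.* suc n)           ≈⟨ -‿cong (×1-homo-* m (suc n)) ⟩
    - (nat m * nat (suc n))       ≈⟨ -‿distribʳ-* _ _ ⟩
    nat m * - nat (suc n)         ∎

  ι-* : ∀ i j → ι (i ℤ.* j) ≈ ι i * ι j
  ι-* (+ m)    j = ι-*-nonNegˡ m j
  ι-* -[1+ m ] j = begin
    ι (ℤ.- (+ suc m) ℤ.* j)       ≡⟨ ≡.cong ι (ℤₚ.neg-distribˡ-* (+ suc m) j) ⟨
    ι (ℤ.- (+ suc m ℤ.* j))       ≈⟨ ι-neg (+ suc m ℤ.* j) ⟩
    - ι (+ suc m ℤ.* j)           ≈⟨ -‿cong (ι-*-nonNegˡ (suc m) j) ⟩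
    - (nat (suc m) * ι j)         ≈⟨ -‿distribˡ-* _ _ ⟩
    - nat (suc m) * ι j           ∎

  -- By characteristic zero. This carries equations proved in the field back to the integers.
  ι-injective-0 : ∀ i → ι i ≈ 0# → i ≡ + 0
  ι-injective-0 (+ zero)  _ = ≡.refl
  ι-injective-0 (+ suc n) e = ⊥-elim (nat≉0 n e)
  ι-injective-0 -[1+ n ]  e =
    ⊥-elim (nat≉0 n (trans (sym (⁻¹-involutive _)) (trans (-‿cong e) -0#≈0#)))

  ι-homomorphism : ℤ.+-*-rawRing -Raw-AlmostCommutative⟶ fromCommutativeRing commutativeRing
  ι-homomorphism = record
    { ⟦_⟧    = ι
    ; +-homo = ι-+
    ; *-homo = ι-*
    ; -‿homo = ι-neg
    ; 0-homo = refl
    ; 1-homo = refl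
    }

  -- The test by which the ring solver compares coefficients. For distinct integers `nothing` claims
  -- nothing about the field, so equality in the field need not be decided.
  ι-≟ : ∀ i j → Maybe (ι i ≈ ι j)
  ι-≟ i j with i ℤ.≟ j
  ... | yes i≡j = just (reflexive (≡.cong ι i≡j))
  ... | no  _   = nothing

  open Algebra.Solver.Ring ℤ.+-*-rawRing (fromCommutativeRing commutativeRing) ι-homomorphism ι-≟ public
    using (solve; con; _:=_; _:+_; _:*_; _:-_; :-_)

-- The Kronecker delta

δ-diagonal : ∀ {n} (i : Fin n) → δ i i ≡ + 1
δ-diagonal i = ≡.cong (λ b → if b then + 1 else + 0) (dec-true (i ≟ i) ≡.refl)

δ-offDiagonal : ∀ {n} {i j : Fin n} → i ≢ j → δ i j ≡ + 0
δ-offDiagonal {i = i} {j} i≢j = ≡.cong (λ b → if b then + 1 else + 0) (dec-false (i ≟ j) i≢j)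

δ-symmetric : ∀ {n} (i j : Fin n) → δ i j ≡ δ j i
δ-symmetric i j with i ≟ j
... | yes ≡.refl = ≡.sym (δ-diagonal i)
... | no i≢j     = ≡.sym (δ-offDiagonal (i≢j ∘ ≡.sym))

-- Eigenvalues over an algebraically closed field

module LinearAlgebra {c ℓ : Level} (K : ACField c ℓ) where
  open Field K

  x-y≈0⇒x≈y : ∀ {x y} → x - y ≈ 0# → x ≈ y
  x-y≈0⇒x≈y = x∙y⁻¹≈ε⇒x≈y _ _

  x≈y⇒x-y≈0 : ∀ {x y} → x ≈ y → x - y ≈ 0#
  x≈y⇒x-y≈0 = x≈y⇒x∙y⁻¹≈ε

  *-cancelˡ-0 : ∀ {x y} → ¬ x ≈ 0# → x * y ≈ 0# → y ≈ 0#
  *-cancelˡ-0 {x} {y} x≉0 xy≈0 with inverse x x≉0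
  ... | x⁻¹ , xx⁻¹≈1 = begin
    y              ≈⟨ *-identityˡ y ⟨
    1# * y         ≈⟨ *-congʳ xx⁻¹≈1 ⟨
    x * x⁻¹ * y    ≈⟨ solve 3 (λ x i y → x :* i :* y := i :* (x :* y)) refl x x⁻¹ y ⟩
    x⁻¹ * (x * y)  ≈⟨ *-congˡ xy≈0 ⟩
    x⁻¹ * 0#       ≈⟨ zeroʳ x⁻¹ ⟩
    0#             ∎

  *-cancelˡ : ∀ {x y z} → ¬ x ≈ 0# → x * y ≈ x * z → y ≈ z
  *-cancelˡ {x} {y} {z} x≉0 e = x-y≈0⇒x≈y (*-cancelˡ-0 x≉0 (begin
    x * (y - z)    ≈⟨ solve 3 (λ x y z → x :* (y :- z) := x :* y :- x :* z) refl x y z ⟩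
    x * y - x * z  ≈⟨ x≈y⇒x-y≈0 e ⟩
    0#             ∎))

  -- Refuting the first alternative makes `x` invertible, which yields the second; choosing between
  -- them outright would need a test for zero.
  zero-product : ∀ {x y} → x * y ≈ 0# → ¬ ¬ (x ≈ 0# ⊎ y ≈ 0#)
  zero-product xy≈0 k = k (inj₂ (*-cancelˡ-0 (λ x≈0 → k (inj₁ x≈0)) xy≈0))

  -- Vectors and matrices

  Vector : ℕ → Set c
  Vector n = Fin n → Carrier

  Matrix : ℕ → ℕ → Set c
  Matrix m n = Fin m → Fin n → Carrier

  infixr 8 _⊛_
  _⊛_ : ∀ {m n} → Matrix m n → Vector n → Vector m
  (A ⊛ x) i = sum (λ j → A i j * x j)

  transpose : ∀ {m n} → Matrix m n → Matrix n m
  transpose A i j = A j i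

  trace : ∀ {n} → Matrix n n → Carrier
  trace A = sum (λ i → A i i)

  Nonzero : ∀ {n} → Vector n → Set ℓ
  Nonzero x = ∃ λ i → ¬ x i ≈ 0#

  Eigenvector : ∀ {n} → Matrix n n → Carrier → Vector n → Set ℓ
  Eigenvector M r x = Nonzero x × (∀ i → (M ⊛ x) i ≈ r * x i)

  Eigenvalue : ∀ {n} → Matrix n n → Carrier → Set (c ⊔ ℓ)
  Eigenvalue M r = ∃ (Eigenvector M r)

  sum-cong : ∀ {n} {x y : Vector n} → (∀ i → x i ≈ y i) → sum x ≈ sum y
  sum-cong = sum-cong-≋

  sum-linear : ∀ {n} a b (x y : Vector n) → sum (λ i → a * x i + b * y i) ≈ a * sum x + b * sum y
  sum-linear a b x y = trans (∑-distrib-+ (λ i → a * x i) (λ i → b * y i))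
    (+-cong (sym (*-distribˡ-sum a x)) (sym (*-distribˡ-sum b y)))

  sum-zero : ∀ {n} {x : Vector n} → (∀ i → x i ≈ 0#) → sum x ≈ 0#
  sum-zero {n} x≈0 = trans (sum-cong x≈0) (sum-replicate-zero n)

  sum-const : ∀ n x → sum {n} (λ _ → x) ≈ nat n * x
  sum-const zero    x = sym (zeroˡ x)
  sum-const (suc n) x = trans (+-congˡ (sum-const n x))
    (trans (solve 2 (λ x k → x :+ k :* x := (con (+ 1) :+ k) :* x)
         refl x (nat n)) (*-congʳ (sym (nat-suc n))))

  scale-⊛ : ∀ {m n} a (A : Matrix m n) x i → ((λ i j → a * A i j) ⊛ x) i ≈ a * (A ⊛ x) i
  scale-⊛ a A x i = trans (sum-cong (λ j → *-assoc a (A i j) (x j)))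
    (sym (*-distribˡ-sum a (λ j → A i j * x j)))

  +-⊛ : ∀ {m n} (A B : Matrix m n) x i → ((λ i j → A i j + B i j) ⊛ x) i ≈ (A ⊛ x) i + (B ⊛ x) i
  +-⊛ A B x i = trans (sum-cong (λ j → distribʳ (x j) (A i j) (B i j)))
    (∑-distrib-+ (λ j → A i j * x j) (λ j → B i j * x j))

  ⊛-congˡ : ∀ {m n} (A : Matrix m n) {x y} → (∀ j → x j ≈ y j) → ∀ i → (A ⊛ x) i ≈ (A ⊛ y) i
  ⊛-congˡ A x≈y i = sum-cong (λ j → *-congˡ (x≈y j))

  ⊛-linear : ∀ {m n} (A : Matrix m n) a b x y i →
             (A ⊛ (λ j → a * x j + b * y j)) i ≈ a * (A ⊛ x) i + b * (A ⊛ y) i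
  ⊛-linear A a b x y i = trans
    (sum-cong (λ j → solve 5 (λ p a b x y → p :* (a :* x :+ b :* y) := a :* (p :* x) :+ b :* (p :* y))
      refl (A i j) a b (x j) (y j)))
    (sum-linear a b (λ j → A i j * x j) (λ j → A i j * y j))

  ⊛-scale : ∀ {m n} (A : Matrix m n) a x i → (A ⊛ (λ j → a * x j)) i ≈ a * (A ⊛ x) i
  ⊛-scale A a x i = trans
    (sum-cong (λ j → solve 3 (λ p a x → p :* (a :* x) := a :* (p :* x)) refl (A i j) a (x j)))
    (sym (*-distribˡ-sum a (λ j → A i j * x j)))

  ⊛-zero : ∀ {m n} (A : Matrix m n) {x} → (∀ j → x j ≈ 0#) → ∀ i → (A ⊛ x) i ≈ 0#
  ⊛-zero A x≈0 i = sum-zero (λ j → trans (*-congˡ (x≈0 j)) (zeroʳ _))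

  sum-⊛ : ∀ {m n} (A : Matrix m n) x → sum (A ⊛ x) ≈ sum (λ j → sum (λ i → A i j) * x j)
  sum-⊛ A x = trans (∑-comm (λ i j → A i j * x j))
    (sum-cong (λ j → sym (*-distribʳ-sum (x j) (λ i → A i j))))

  infixr 9 _⊗_
  _⊗_ : ∀ {l m n} → Matrix l m → Matrix m n → Matrix l n
  (A ⊗ B) i k = sum (λ j → A i j * B j k)

  ⊛-⊗ : ∀ {l m n} (A : Matrix l m) (B : Matrix m n) x i → ((A ⊗ B) ⊛ x) i ≈ (A ⊛ B ⊛ x) i
  ⊛-⊗ A B x i = begin
    sum (λ k → sum (λ j → A i j * B j k) * x k)
      ≈⟨ sum-cong (λ k → *-distribʳ-sum (x k) (λ j → A i j * B j k)) ⟩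
    sum (λ k → sum (λ j → A i j * B j k * x k))
      ≈⟨ ∑-comm (λ k j → A i j * B j k * x k) ⟩
    sum (λ j → sum (λ k → A i j * B j k * x k))
      ≈⟨ sum-cong (λ j → trans (sum-cong (λ k → *-assoc (A i j) (B j k) (x k)))
           (sym (*-distribˡ-sum (A i j) (λ k → B j k * x k)))) ⟩
    sum (λ j → A i j * (B ⊛ x) j) ∎

  -- Underdetermined linear systems

  zero-or-nonzero : ∀ {n} (x : Vector n) → ¬ ¬ ((∀ i → x i ≈ 0#) ⊎ Nonzero x)
  zero-or-nonzero {zero}  x = pure (inj₁ λ ())
  zero-or-nonzero {suc n} x = do
    inj₁ x₊≈0 ← zero-or-nonzero (x ∘ suc)
      where inj₂ (i , xᵢ≉0) → pure (inj₂ (suc i , xᵢ≉0))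
    yes x₀≈0 ← ¬¬-excluded-middle
      where no x₀≉0 → pure (inj₂ (zero , x₀≉0))
    pure (inj₁ λ { zero → x₀≈0 ; (suc i) → x₊≈0 i })

  ⊛-insertAt : ∀ {m n} (A : Matrix m (suc n)) x p t i →
               (A ⊛ insertAt x p t) i ≈ A i p * t + ((λ k j → A k (punchIn p j)) ⊛ x) i
  ⊛-insertAt A x p t i = trans (sum-remove (λ j → A i j * insertAt x p t j))
    (+-cong (*-congˡ (reflexive (insertAt-lookup x p t)))
      (sum-cong (λ j → *-congˡ (reflexive (insertAt-punchIn x p t j)))))

  Nonzero-insertAt : ∀ {n} {x : Vector n} p t → Nonzero x → Nonzero (insertAt x p t)
  Nonzero-insertAt {x = x} p t (i , xᵢ≉0) =
    punchIn p i , λ e → xᵢ≉0 (trans (sym (reflexive (insertAt-punchIn x p t i))) e)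

  -- Gaussian elimination on the first row: either the row vanishes and is dropped, or one of its
  -- nonzero entries serves as pivot and its column is eliminated from the other rows.
  kernel : ∀ n (A : Matrix n (suc n)) → ¬ ¬ ∃ λ x → Nonzero x × (∀ i → (A ⊛ x) i ≈ 0#)
  kernel zero    A = pure ((λ _ → 1#) , (zero , nontrivial) , λ ())
  kernel (suc n) A = zero-or-nonzero (A zero) >>= λ where
    (inj₁ A₀≈0) → do
      -- Setting the first unknown to 0 removes a column along with the vanishing row, so one
      -- unknown remains in excess.
      x , x≉0 , Ax≈0 ← kernel n (λ i j → A (suc i) (suc j))
      pure (insertAt x zero 0# , Nonzero-insertAt zero 0# x≉0 , λ where
        zero    → sum-zero (λ j → trans (*-congʳ (A₀≈0 j)) (zeroˡ (insertAt x zero 0# j)))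
        (suc i) → trans (+-cong (zeroʳ _) (Ax≈0 i)) (+-identityˡ _))
    (inj₂ (p , a≉0)) →
      let a⁻¹ , aa⁻¹≈1 = inverse (A zero p) a≉0
          A′ : Matrix (suc n) (suc n)
          A′ i j = A i (punchIn p j)
      in do
      -- The factor `1#` gives the row operation the shape that `sum-linear` expects.
      x , x≉0 , Bx≈0 ← kernel n (λ i j → 1# * A′ (suc i) j + - (A (suc i) p * a⁻¹) * A′ zero j)
      -- Solves the first equation for the pivot unknown.
      let t = - a⁻¹ * (A′ ⊛ x) zero
      pure (insertAt x p t , Nonzero-insertAt p t x≉0 , λ where
        zero → begin
          (A ⊛ insertAt x p t) zero
            ≈⟨ ⊛-insertAt A x p t zero ⟩
          A zero p * t + (A′ ⊛ x) zero
            ≈⟨ solve 3 (λ a i s → a :* (:- i :* s) :+ s := (con (+ 1) :- a :* i) :* s) refl (A zero p) a⁻¹ _ ⟩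
          (1# - A zero p * a⁻¹) * (A′ ⊛ x) zero
            ≈⟨ *-congʳ (x≈y⇒x-y≈0 (sym aa⁻¹≈1)) ⟩
          0# * (A′ ⊛ x) zero
            ≈⟨ zeroˡ _ ⟩
          0# ∎
        (suc i) → begin
          (A ⊛ insertAt x p t) (suc i)
            ≈⟨ ⊛-insertAt A x p t (suc i) ⟩
          A (suc i) p * t + (A′ ⊛ x) (suc i)
            ≈⟨ solve 4 (λ b i s u → b :* (:- i :* s) :+ u := con (+ 1) :* u :+ :- (b :* i) :* s)
                 refl (A (suc i) p) a⁻¹ _ _ ⟩
          1# * (A′ ⊛ x) (suc i) + - (A (suc i) p * a⁻¹) * (A′ ⊛ x) zero
            ≈⟨ sum-linear 1# (- (A (suc i) p * a⁻¹)) (λ j → A′ (suc i) j * x j) (λ j → A′ zero j * x j) ⟨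
          sum (λ j → 1# * (A′ (suc i) j * x j) + - (A (suc i) p * a⁻¹) * (A′ zero j * x j))
            ≈⟨ sum-cong (λ j → solve 5 (λ o u v w x → o :* (u :* x) :+ v :* (w :* x)
                 := (o :* u :+ v :* w) :* x)
                 refl 1# (A′ (suc i) j) (- (A (suc i) p * a⁻¹)) (A′ zero j) (x j)) ⟩
          sum (λ j → (1# * A′ (suc i) j + - (A (suc i) p * a⁻¹) * A′ zero j) * x j)
            ≈⟨ Bx≈0 i ⟩
          0# ∎)

  identity : ∀ {n} → Matrix n n
  identity i j = ι (δ i j)

  ⊛-identity : ∀ {n} (x : Vector n) i → (identity ⊛ x) i ≈ x i
  ⊛-identity x zero = trans
    (+-cong (*-identityˡ (x zero)) (sum-zero (λ j → zeroˡ (x (suc j))))) (+-identityʳ _)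
  ⊛-identity x (suc i) = trans
    (+-cong (zeroˡ (x zero)) (⊛-identity (x ∘ suc) i)) (+-identityˡ _)

  punchIn-cases : ∀ {n p} (P : Fin (suc n) → Set p) i → P i → (∀ j → P (punchIn i j)) → ∀ j → P j
  punchIn-cases P i Pᵢ P₋ j with i ≟ j
  ... | yes ≡.refl = Pᵢ
  ... | no i≢j     = ≡.subst P (punchIn-punchOut i≢j) (P₋ (punchOut i≢j))

  adjoint : ∀ {m n} (A : Matrix m n) x y →
            sum (λ i → x i * (A ⊛ y) i) ≈ sum (λ j → (transpose A ⊛ x) j * y j)
  adjoint A x y = begin
    sum (λ i → x i * (A ⊛ y) i)
      ≈⟨ sum-cong (λ i → *-distribˡ-sum (x i) (λ j → A i j * y j)) ⟩
    sum (λ i → sum (λ j → x i * (A i j * y j)))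
      ≈⟨ ∑-comm (λ i j → x i * (A i j * y j)) ⟩
    sum (λ j → sum (λ i → x i * (A i j * y j)))
      ≈⟨ sum-cong (λ j → sum-cong (λ i →
           solve 3 (λ x a y → x :* (a :* y) := a :* x :* y) refl (x i) (A i j) (y j))) ⟩
    sum (λ j → sum (λ i → A i j * x i * y j))
      ≈⟨ sum-cong (λ j → *-distribʳ-sum (y j) (λ i → A i j * x i)) ⟨
    sum (λ j → (transpose A ⊛ x) j * y j) ∎

  -- A left eigenvector makes one row of M - r I a combination of the others,
  -- so a vector killed by the other rows is a right eigenvector.
  transpose-eigenvalue : ∀ {n r} (M : Matrix n n) → Eigenvalue (transpose M) r → ¬ ¬ Eigenvalue M r
  transpose-eigenvalue {suc n} {r} M (x , (i , xᵢ≉0) , Mᵀx≈rx) = do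
    y , y≉0 , By≈0 ← kernel n (λ a → B (punchIn i a))
    pure (y , y≉0 , λ a → x-y≈0⇒x≈y (trans (sym (shift y a)) (rows y By≈0 a)))
    where
    B : Matrix (suc n) (suc n)
    B a b = 1# * M a b + - r * identity a b

    shift : ∀ y a → (B ⊛ y) a ≈ (M ⊛ y) a - r * y a
    shift y a = begin
      (B ⊛ y) a
        ≈⟨ sum-cong (λ b → solve 5 (λ o m r e y → (o :* m :+ r :* e) :* y := o :* (m :* y) :+ r :* (e :* y))
             refl 1# (M a b) (- r) (identity a b) (y b)) ⟩
      sum (λ b → 1# * (M a b * y b) + - r * (identity a b * y b))
        ≈⟨ sum-linear 1# (- r) (λ b → M a b * y b) (λ b → identity a b * y b) ⟩
      1# * (M ⊛ y) a + - r * (identity ⊛ y) a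
        ≈⟨ +-cong (*-identityˡ _) (trans (*-congˡ (⊛-identity y a)) (sym (-‿distribˡ-* r (y a)))) ⟩
      (M ⊛ y) a - r * y a ∎

    -- The left eigenvector `x` annihilates the image of M - r I. This is the relation between the
    -- rows of `B`; its coefficient at row `i` is invertible.
    orthogonal : ∀ y → sum (λ a → x a * (B ⊛ y) a) ≈ 0#
    orthogonal y = begin
      sum (λ a → x a * (B ⊛ y) a)
        ≈⟨ sum-cong (λ a → trans (*-congˡ (shift y a))
             (solve 4 (λ x m r y → x :* (m :- r :* y) := con (+ 1) :* (x :* m) :+ :- r :* (x :* y))
               refl (x a) ((M ⊛ y) a) r (y a))) ⟩
      sum (λ a → 1# * (x a * (M ⊛ y) a) + - r * (x a * y a))
        ≈⟨ sum-linear 1# (- r) (λ a → x a * (M ⊛ y) a) (λ a → x a * y a) ⟩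
      1# * sum (λ a → x a * (M ⊛ y) a) + - r * sum (λ a → x a * y a)
        ≈⟨ +-cong (*-identityˡ _) (sym (-‿distribˡ-* r _)) ⟩
      sum (λ a → x a * (M ⊛ y) a) - r * sum (λ a → x a * y a)
        ≈⟨ x≈y⇒x-y≈0 (begin
             sum (λ a → x a * (M ⊛ y) a)           ≈⟨ adjoint M x y ⟩
             sum (λ b → (transpose M ⊛ x) b * y b)
               ≈⟨ sum-cong (λ b → trans (*-congʳ (Mᵀx≈rx b)) (*-assoc r (x b) (y b))) ⟩
             sum (λ b → r * (x b * y b))            ≈⟨ *-distribˡ-sum r (λ b → x b * y b) ⟨
             r * sum (λ a → x a * y a)              ∎) ⟩
      0# ∎

    rows : ∀ y → (∀ a → (B ⊛ y) (punchIn i a) ≈ 0#) → ∀ a → (B ⊛ y) a ≈ 0#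
    rows y By≈0 = punchIn-cases (λ a → (B ⊛ y) a ≈ 0#) i (*-cancelˡ-0 xᵢ≉0 (begin
      x i * (B ⊛ y) i
        ≈⟨ +-identityʳ _ ⟨
      x i * (B ⊛ y) i + 0#
        ≈⟨ +-congˡ (sum-zero (λ a → trans (*-congˡ (By≈0 a)) (zeroʳ (x (punchIn i a))))) ⟨
      x i * (B ⊛ y) i + sum (λ a → x (punchIn i a) * (B ⊛ y) (punchIn i a))
        ≈⟨ sum-remove {i = i} (λ a → x a * (B ⊛ y) a) ⟨
      sum (λ a → x a * (B ⊛ y) a)
        ≈⟨ orthogonal y ⟩
      0# ∎)) By≈0

  -- Monic polynomials evaluated at a matrix

  -- A vector as : Vec Carrier k encodes the monic polynomial of degree k whose
  -- lower coefficients are as, constant term first.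
  monic : ∀ {k} → Vec Carrier k → Carrier → Carrier
  monic []       x = 1#
  monic (a ∷ as) x = a + x * monic as x

  monic-root : ∀ {k} (as : Vec Carrier (suc k)) → ∃ λ x → monic as x ≈ 0#
  monic-root (a ∷ as) with algClosed a (toList as)
  ... | x , root = x , trans (sym (evalPoly-monic (a ∷ as))) root
    where
    evalPoly-monic : ∀ {k} (as : Vec Carrier k) →
                     evalPoly commutativeRing (toList as ++ 1# ∷ []) x ≈ monic as x
    evalPoly-monic []       = trans (+-congˡ (zeroʳ x)) (+-identityʳ 1#)
    evalPoly-monic (a ∷ as) = +-congˡ (*-congˡ (evalPoly-monic as))

  square-root : ∀ x → ∃ λ y → y * y ≈ x
  square-root x with monic-root (- x ∷ 0# ∷ [])
  ... | y , root = y , x-y≈0⇒x≈y (trans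
    (solve 2 (λ x y → y :* y :- x := :- x :+ y :* (con (+ 0) :+ y :* con (+ 1))) refl x y) root)

  -- The vector p(M) v, computed by Horner's rule without forming the matrix p(M).
  monicAct : ∀ {n k} → Matrix n n → Vec Carrier k → Vector n → Vector n
  monicAct M []       v i = v i
  monicAct M (a ∷ as) v i = a * v i + (M ⊛ monicAct M as v) i

  -- c ∷ as plus r times qs, as monic polynomials
  addScaled : ∀ {k} → Carrier → Carrier → Vec Carrier k → Vec Carrier k → Vec Carrier (suc k)
  addScaled r c []       []       = (c + r) ∷ []
  addScaled r c (a ∷ as) (q ∷ qs) = (c + r * q) ∷ addScaled r a as qs

  -- The quotient of any b ∷ as by x - r; it does not depend on b.
  quotient : ∀ {k} → Carrier → Vec Carrier k → Vec Carrier k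
  quotient r []       = []
  quotient r (c ∷ as) = addScaled r c as (quotient r as)

  addScaled-act : ∀ {n k} (M : Matrix n n) r c (as qs : Vec Carrier k) v i →
    monicAct M (addScaled r c as qs) v i ≈ 1# * monicAct M (c ∷ as) v i + r * monicAct M qs v i
  addScaled-act M r c [] [] v i =
    solve 4 (λ c r v m → (c :+ r) :* v :+ m := con (+ 1) :* (c :* v :+ m) :+ r :* v) refl c r (v i) _
  addScaled-act M r c (a ∷ as) (q ∷ qs) v i = begin
    (c + r * q) * v i + (M ⊛ monicAct M (addScaled r a as qs) v) i
      ≈⟨ +-congˡ (trans (⊛-congˡ M (addScaled-act M r a as qs v) i)
           (⊛-linear M 1# r (monicAct M (a ∷ as) v) (monicAct M qs v) i)) ⟩
    (c + r * q) * v i + (1# * (M ⊛ monicAct M (a ∷ as) v) i + r * (M ⊛ monicAct M qs v) i)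
      ≈⟨ solve 6 (λ c r q v m n → (c :+ r :* q) :* v :+ (con (+ 1) :* m :+ r :* n)
           := con (+ 1) :* (c :* v :+ m) :+ r :* (q :* v :+ n)) refl c r q (v i) _ _ ⟩
    1# * (c * v i + (M ⊛ monicAct M (a ∷ as) v) i) + r * (q * v i + (M ⊛ monicAct M qs v) i) ∎

  -- Division with remainder, p(X) = (X - r) q(X) + p(r), evaluated at `M` and applied to `v`.
  quotient-act : ∀ {n k} (M : Matrix n n) r b (as : Vec Carrier k) v i →
    monicAct M (b ∷ as) v i ≈
    (M ⊛ monicAct M (quotient r as) v) i - r * monicAct M (quotient r as) v i + monic (b ∷ as) r * v i
  quotient-act M r b [] v i =
    solve 4 (λ b r v m → b :* v :+ m := m :- r :* v :+ (b :+ r :* con (+ 1)) :* v) refl b r (v i) _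
  quotient-act M r b (c ∷ as) v i = begin
    b * v i + (M ⊛ p) i
      ≈⟨ solve 5 (λ b v m r k → b :* v :+ m := m :- r :* k :+ (b :* v :+ r :* k)) refl b (v i) _ r (p i) ⟩
    (M ⊛ p) i - r * p i + (b * v i + r * p i)
      ≈⟨ +-congˡ (+-congˡ (*-congˡ (quotient-act M r c as v i))) ⟩
    (M ⊛ p) i - r * p i + (b * v i + r * ((M ⊛ q) i - r * q i + e * v i))
      ≈⟨ solve 8 (λ b v m r k n q e → m :- r :* k :+ (b :* v :+ r :* (n :- r :* q :+ e :* v))
           := (con (+ 1) :* m :+ r :* n) :- r :* (con (+ 1) :* k :+ r :* q) :+ (b :+ r :* e) :* v)
           refl b (v i) _ r (p i) _ (q i) e ⟩
    (1# * (M ⊛ p) i + r * (M ⊛ q) i) - r * (1# * p i + r * q i) + (b + r * e) * v i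
      ≈⟨ +-congʳ (+-cong
           (trans (⊛-congˡ M (addScaled-act M r c as (quotient r as) v) i) (⊛-linear M 1# r p q i))
           (-‿cong (*-congˡ (addScaled-act M r c as (quotient r as) v i)))) ⟨
    (M ⊛ s) i - r * s i + (b + r * e) * v i ∎
    where
    p = monicAct M (c ∷ as) v
    q = monicAct M (quotient r as) v
    s = monicAct M (quotient r (c ∷ as)) v
    e = monic (c ∷ as) r

  -- Take a root r of p and write p(X) = (X - r) q(X). If q(M) v is nonzero, it is an eigenvector
  -- for r; otherwise q annihilates `v` and has smaller degree. In degree 0 the hypothesis says that
  -- `v` vanishes.
  eigenvalue-of-annihilator : ∀ {n k} (M : Matrix n n) (as : Vec Carrier k) v → Nonzero v →
    (∀ i → monicAct M as v i ≈ 0#) → ¬ ¬ ∃ (Eigenvalue M)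
  eigenvalue-of-annihilator M [] v (i , vᵢ≉0) v≈0 _ = vᵢ≉0 (v≈0 i)
  eigenvalue-of-annihilator M (b ∷ as) v v≉0 p≈0 with monic-root (b ∷ as)
  ... | r , root = zero-or-nonzero q >>= λ where
      (inj₁ q≈0) → eigenvalue-of-annihilator M (quotient r as) v v≉0 q≈0
      (inj₂ q≉0) → pure (r , q , q≉0 , λ i → x-y≈0⇒x≈y (begin
        (M ⊛ q) i - r * q i                           ≈⟨ +-identityʳ _ ⟨
        (M ⊛ q) i - r * q i + 0#                      ≈⟨ +-congˡ (trans (*-congʳ root) (zeroˡ (v i))) ⟨
        (M ⊛ q) i - r * q i + monic (b ∷ as) r * v i  ≈⟨ quotient-act M r b as v i ⟨
        monicAct M (b ∷ as) v i                       ≈⟨ p≈0 i ⟩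
        0#                                            ∎))
    where q = monicAct M (quotient r as) v

  -- Existence of an eigenvalue

  power : ∀ {n} → Matrix n n → ℕ → Vector n → Vector n
  power M zero    v = v
  power M (suc j) v = M ⊛ power M j v

  polyAct : ∀ {n k} → Matrix n n → Vector k → Vector n → Vector n
  polyAct {k = zero}  M c v i = 0#
  polyAct {k = suc k} M c v i = c zero * v i + (M ⊛ polyAct M (c ∘ suc) v) i

  -- Turns a linear dependence among v, M v, M² v, ... into a polynomial that annihilates `v`.
  polyAct-power : ∀ {n k} (M : Matrix n n) (c : Vector k) v i →
                  sum (λ j → power M (toℕ j) v i * c j) ≈ polyAct M c v i
  polyAct-power {k = zero}  M c v i = refl
  polyAct-power {k = suc k} M c v i = +-cong (*-comm _ _) (begin
    sum (λ j → (M ⊛ w j) i * c (suc j))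
      ≈⟨ sum-cong (λ j → *-distribʳ-sum (c (suc j)) (λ a → M i a * w j a)) ⟩
    sum (λ j → sum (λ a → M i a * w j a * c (suc j)))
      ≈⟨ ∑-comm (λ j a → M i a * w j a * c (suc j)) ⟩
    sum (λ a → sum (λ j → M i a * w j a * c (suc j)))
      ≈⟨ sum-cong (λ a → trans (sum-cong (λ j → *-assoc (M i a) (w j a) (c (suc j))))
           (sym (*-distribˡ-sum (M i a) (λ j → w j a * c (suc j))))) ⟩
    sum (λ a → M i a * sum (λ j → w j a * c (suc j)))
      ≈⟨ ⊛-congˡ M (polyAct-power M (c ∘ suc) v) i ⟩
    (M ⊛ polyAct M (c ∘ suc) v) i ∎)
    where
    w : Fin k → Vector _
    w j = power M (toℕ j) v

  polyAct-zero : ∀ {n k} (M : Matrix n n) (c : Vector k) v → (∀ j → c j ≈ 0#) → ∀ i → polyAct M c v i ≈ 0#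
  polyAct-zero {k = zero}  M c v c≈0 i = refl
  polyAct-zero {k = suc k} M c v c≈0 i = trans
    (+-cong (trans (*-congʳ (c≈0 zero)) (zeroˡ (v i)))
            (⊛-zero M (polyAct-zero M (c ∘ suc) v (c≈0 ∘ suc)) i))
    (+-identityˡ 0#)

  -- Divides by the last nonzero coefficient `u`. Its position, hence the degree `d`, is found by
  -- testing tails for zero, which is possible only under double negation.
  normalise : ∀ {n k} (M : Matrix n n) (c : Vector k) v → Nonzero c →
    ¬ ¬ ∃ λ u → ¬ u ≈ 0# × ∃ λ d → ∃ λ (as : Vec Carrier d) → ∀ i → polyAct M c v i ≈ u * monicAct M as v i
  normalise {k = suc k} M c v c≉0 = zero-or-nonzero (c ∘ suc) >>= λ where
      (inj₁ c₊≈0) → pure (c zero , leading c≉0 c₊≈0 , 0 , [] , λ i →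
        trans (+-congˡ (⊛-zero M (polyAct-zero M (c ∘ suc) v c₊≈0) i)) (+-identityʳ _))
      (inj₂ c₊≉0) → do
        u , u≉0 , d , as , p≈uas ← normalise M (c ∘ suc) v c₊≉0
        let u⁻¹ , uu⁻¹≈1 = inverse u u≉0
        pure (u , u≉0 , suc d , c zero * u⁻¹ ∷ as , λ i → begin
          c zero * v i + (M ⊛ polyAct M (c ∘ suc) v) i
            ≈⟨ +-cong (*-congʳ (trans (sym (*-identityʳ _)) (*-congˡ (sym uu⁻¹≈1))))
                 (trans (⊛-congˡ M p≈uas i) (⊛-scale M u (monicAct M as v) i)) ⟩
          c zero * (u * u⁻¹) * v i + u * (M ⊛ monicAct M as v) i
            ≈⟨ solve 5 (λ c u w v m → c :* (u :* w) :* v :+ u :* m := u :* (c :* w :* v :+ m))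
                 refl (c zero) u u⁻¹ (v i) _ ⟩
          u * (c zero * u⁻¹ * v i + (M ⊛ monicAct M as v) i) ∎)
    where
    leading : Nonzero c → (∀ j → c (suc j) ≈ 0#) → ¬ c zero ≈ 0#
    leading (zero  , c₀≉0) c₊≈0 = c₀≉0
    leading (suc j , cⱼ≉0) c₊≈0 = ⊥-elim (cⱼ≉0 (c₊≈0 j))

  eigenvalue-exists : ∀ {n} (M : Matrix (suc n) (suc n)) → ¬ ¬ ∃ (Eigenvalue M)
  eigenvalue-exists {n} M = do
    -- The n + 2 vectors v, M v, ..., up to exponent n + 1, are dependent in dimension n + 1.
    c , c≉0 , Σc≈0 ← kernel (suc n) (λ i j → power M (toℕ j) v i)
    u , u≉0 , _ , as , p≈uas ← normalise M c v c≉0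
    eigenvalue-of-annihilator M as v (zero , nontrivial) (λ i →
      *-cancelˡ-0 u≉0 (trans (sym (p≈uas i)) (trans (sym (polyAct-power M c v i)) (Σc≈0 i))))
    where
    v : Vector (suc n)
    v _ = 1#

  -- Deflation, and the trace as a sum of eigenvalues

  module Deflation {n} (M : Matrix (suc n) (suc n)) (r : Carrier) (x : Vector (suc n)) (i : Fin (suc n))
    (xᵢ≈1 : x i ≈ 1#) (Mx≈rx : ∀ j → (M ⊛ x) j ≈ r * x j) where

    -- M on the quotient by the line through x, where e_i = - Σ x_a e_a
    deflate : Matrix n n
    deflate a b = 1# * M (punchIn i a) (punchIn i b) + - x (punchIn i a) * M i (punchIn i b)

    -- Since `x i` is 1, coordinate `i` of M x = r x expresses r as `M i i` plus exactly the terms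
    -- that deflation subtracts along the diagonal.
    trace-deflate : trace M ≈ r + trace deflate
    trace-deflate = begin
      trace M
        ≈⟨ sum-remove {i = i} (λ j → M j j) ⟩
      M i i + t
        ≈⟨ solve 3 (λ m t u → m :+ t := m :* con (+ 1) :+ u :+ (con (+ 1) :* t :+ :- con (+ 1) :* u))
             refl (M i i) t u ⟩
      M i i * 1# + u + (1# * t + - 1# * u)
        ≈⟨ +-cong (begin
             M i i * 1# + u   ≈⟨ +-congʳ (*-congˡ xᵢ≈1) ⟨
             M i i * x i + u  ≈⟨ sum-remove {i = i} (λ j → M i j * x j) ⟨
             (M ⊛ x) i        ≈⟨ Mx≈rx i ⟩
             r * x i          ≈⟨ trans (*-congˡ xᵢ≈1) (*-identityʳ r) ⟩
             r                ∎)
           (begin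
             1# * t + - 1# * u
               ≈⟨ sum-linear 1# (- 1#) (λ a → M (punchIn i a) (punchIn i a))
                    (λ a → M i (punchIn i a) * x (punchIn i a)) ⟨
             sum (λ a → 1# * M (punchIn i a) (punchIn i a) + - 1# * (M i (punchIn i a) * x (punchIn i a)))
               ≈⟨ sum-cong (λ a → +-congˡ (solve 2 (λ m x → :- con (+ 1) :* (m :* x) := :- x :* m) refl
                    (M i (punchIn i a)) (x (punchIn i a)))) ⟩
             trace deflate ∎) ⟩
      r + trace deflate ∎
      where
      t = sum (λ a → M (punchIn i a) (punchIn i a))
      u = sum (λ a → M i (punchIn i a) * x (punchIn i a))

    -- Extending the eigenvector by 0 at `i` gives a vector y with M y = s y + k x. If s = r, then
    -- `x` itself serves; otherwise y + t x is an eigenvector for s when t (s - r) = k.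
    deflate-eigenvalue : ∀ {s} → Eigenvalue deflate s → ¬ ¬ Eigenvalue M s
    deflate-eigenvalue {s} (y′ , (b , y′ᵦ≉0) , Dy′≈sy′) = ¬¬-excluded-middle >>= λ where
        (yes s≈r) → pure (x , (i , λ xᵢ≈0 → nontrivial (trans (sym xᵢ≈1) xᵢ≈0)) , λ j →
          trans (Mx≈rx j) (*-congʳ (sym s≈r)))
        (no s≉r) →
          let d , [s-r]d≈1 = inverse (s - r) (λ s-r≈0 → s≉r (x-y≈0⇒x≈y s-r≈0))
              t = k * d
              z : Vector (suc n)
              z j = 1# * y j + t * x j
              t[s-r]≈k : t * (s - r) ≈ k
              t[s-r]≈k = trans (solve 3 (λ k d e → k :* d :* e := k :* (e :* d)) refl k d (s - r))
                (trans (*-congˡ [s-r]d≈1) (*-identityʳ k))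
          in zero-or-nonzero z >>= λ where
            -- Coordinate `i` of z is t, so z = 0 would force t = 0 and then y = 0.
            (inj₁ z≈0) _ → y′ᵦ≉0 (begin
              y′ b                                            ≈⟨ yₚ b ⟨
              y (punchIn i b)
                ≈⟨ solve 3 (λ y t x → y := con (+ 1) :* y :+ t :* x :- t :* x)
                     refl (y (punchIn i b)) t (x (punchIn i b)) ⟩
              z (punchIn i b) - t * x (punchIn i b)
                ≈⟨ +-cong (z≈0 (punchIn i b)) (-‿cong (*-congʳ (begin
                     t
                       ≈⟨ solve 1 (λ t → t := con (+ 1) :* con (+ 0) :+ t :* con (+ 1)) refl t ⟩
                     1# * 0# + t * 1#      ≈⟨ +-cong (*-congˡ yᵢ) (*-congˡ xᵢ≈1) ⟨
                     z i                   ≈⟨ z≈0 i ⟩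
                     0#                    ∎))) ⟩
              0# - 0# * x (punchIn i b)
                ≈⟨ solve 1 (λ x → con (+ 0) :- con (+ 0) :* x := con (+ 0)) refl (x (punchIn i b)) ⟩
              0#                                              ∎)
            (inj₂ z≉0) → pure (z , z≉0 , λ j → begin
              (M ⊛ z) j
                ≈⟨ ⊛-linear M 1# t y x j ⟩
              1# * (M ⊛ y) j + t * (M ⊛ x) j
                ≈⟨ +-cong (*-congˡ (My j)) (*-congˡ (Mx≈rx j)) ⟩
              1# * (s * y j + k * x j) + t * (r * x j)
                ≈⟨ +-congʳ (*-congˡ (+-congˡ (*-congʳ (sym t[s-r]≈k)))) ⟩
              1# * (s * y j + t * (s - r) * x j) + t * (r * x j)
                ≈⟨ solve 5 (λ s y t r x → con (+ 1) :* (s :* y :+ t :* (s :- r) :* x) :+ t :* (r :* x)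
                     := s :* (con (+ 1) :* y :+ t :* x)) refl s (y j) t r (x j) ⟩
              s * z j ∎)
      where
      y : Vector (suc n)
      y = insertAt y′ i 0#

      yᵢ : y i ≈ 0#
      yᵢ = reflexive (insertAt-lookup y′ i 0#)

      yₚ : ∀ a → y (punchIn i a) ≈ y′ a
      yₚ a = reflexive (insertAt-punchIn y′ i 0# a)

      w : Vector (suc n)
      w j = sum (λ a → M j (punchIn i a) * y′ a)

      k : Carrier
      k = w i

      My≈w : ∀ j → (M ⊛ y) j ≈ w j
      My≈w j = trans (⊛-insertAt M y′ i 0# j) (trans (+-congʳ (zeroʳ (M j i))) (+-identityˡ _))

      My : ∀ j → (M ⊛ y) j ≈ s * y j + k * x j
      My j = trans (My≈w j) (punchIn-cases (λ j → w j ≈ s * y j + k * x j) i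
        (begin
          k                   ≈⟨ solve 2 (λ s k → k := s :* con (+ 0) :+ k :* con (+ 1)) refl s k ⟩
          s * 0# + k * 1#     ≈⟨ +-cong (*-congˡ yᵢ) (*-congˡ xᵢ≈1) ⟨
          s * y i + k * x i   ∎)
        (λ a → begin
          w (punchIn i a)
            ≈⟨ solve 3 (λ w x k → w := con (+ 1) :* w :+ :- x :* k :+ k :* x)
                 refl (w (punchIn i a)) (x (punchIn i a)) k ⟩
          1# * w (punchIn i a) + - x (punchIn i a) * k + k * x (punchIn i a)
            ≈⟨ +-congʳ (sum-linear 1# (- x (punchIn i a))
                 (λ b → M (punchIn i a) (punchIn i b) * y′ b) (λ b → M i (punchIn i b) * y′ b)) ⟨
          sum (λ b → 1# * (M (punchIn i a) (punchIn i b) * y′ b) + - x (punchIn i a) * (M i (punchIn i b) * y′ b))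
            + k * x (punchIn i a)
            ≈⟨ +-congʳ (sum-cong (λ b → solve 5 (λ o m x p y → o :* (m :* y) :+ x :* (p :* y)
                 := (o :* m :+ x :* p) :* y)
                 refl 1# (M (punchIn i a) (punchIn i b)) (- x (punchIn i a)) (M i (punchIn i b)) (y′ b))) ⟩
          (deflate ⊛ y′) a + k * x (punchIn i a)
            ≈⟨ +-congʳ (trans (Dy′≈sy′ a) (*-congˡ (sym (yₚ a)))) ⟩
          s * y (punchIn i a) + k * x (punchIn i a) ∎) j)

  -- Induction by deflation. Multiplicities are not tracked: each of the n summands is an eigenvalue
  -- of `M`, and `P` records what is known about those.
  trace-eigenvalues : ∀ {n p} (P : Carrier → Set p) (M : Matrix n n) →
    (∀ {r} → Eigenvalue M r → ¬ ¬ P r) → ¬ ¬ ∃ λ (f : Vector n) → (∀ i → P (f i)) × trace M ≈ sum f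
  trace-eigenvalues {zero}  P M spec = pure ((λ ()) , (λ ()) , refl)
  trace-eigenvalues {suc n} P M spec = do
    r , x , (i , xᵢ≉0) , Mx≈rx ← eigenvalue-exists M
    Pr ← spec (x , (i , xᵢ≉0) , Mx≈rx)
    let u , xᵢu≈1 = inverse (x i) xᵢ≉0
        open Deflation M r (λ j → u * x j) i (trans (*-comm u (x i)) xᵢu≈1) (λ j →
          trans (⊛-scale M u x j) (trans (*-congˡ (Mx≈rx j))
            (solve 3 (λ u r x → u :* (r :* x) := r :* (u :* x)) refl u r (x j))))
    f , Pf , tr ← trace-eigenvalues P deflate (λ e → deflate-eigenvalue e >>= spec)
    pure ((λ { zero → r ; (suc j) → f j }) , (λ { zero → Pr ; (suc j) → Pf j })
      , trans trace-deflate (+-congˡ tr))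

  -- From (M - s)(M + s) x = 0: either (M + s) x is an eigenvector for s, or it vanishes and `x` is
  -- one for -s. Writing z in terms of M x and x lets properties such as zero sum pass to z.
  eigenvector-of-square : ∀ {n} (M : Matrix n n) r x → Nonzero x → (∀ i → (M ⊛ M ⊛ x) i ≈ r * x i) →
    ¬ ¬ ∃ λ s → s * s ≈ r × ∃ λ z → Eigenvector M s z ×
      ∃ λ a → ∃ λ b → ∀ i → z i ≈ a * (M ⊛ x) i + b * x i
  eigenvector-of-square M r x x≉0 MMx≈rx =
    let s , ss≈r = square-root r
        z : Vector _
        z i = 1# * (M ⊛ x) i + s * x i
    in zero-or-nonzero z >>= λ where
      (inj₁ z≈0) → pure (- s , trans (solve 1 (λ s → :- s :* :- s := s :* s) refl s) ss≈r
        , x , (x≉0 , λ i → begin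
            (M ⊛ x) i
              ≈⟨ solve 3 (λ m s x → m := con (+ 1) :* m :+ s :* x :+ :- s :* x) refl ((M ⊛ x) i) s (x i) ⟩
            z i + - s * x i      ≈⟨ +-congʳ (z≈0 i) ⟩
            0# + - s * x i       ≈⟨ +-identityˡ _ ⟩
            - s * x i            ∎)
        , 0# , 1# , λ i → solve 2 (λ m x → x := con (+ 0) :* m :+ con (+ 1) :* x) refl ((M ⊛ x) i) (x i))
      (inj₂ z≉0) → pure (s , ss≈r
        , z , (z≉0 , λ i → begin
            (M ⊛ z) i
              ≈⟨ ⊛-linear M 1# s (M ⊛ x) x i ⟩
            1# * (M ⊛ M ⊛ x) i + s * (M ⊛ x) i
              ≈⟨ +-congʳ (*-congˡ (trans (MMx≈rx i) (*-congʳ (sym ss≈r)))) ⟩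
            1# * (s * s * x i) + s * (M ⊛ x) i
              ≈⟨ solve 3 (λ s x m → con (+ 1) :* (s :* s :* x) :+ s :* m := s :* (con (+ 1) :* m :+ s :* x))
                   refl s (x i) ((M ⊛ x) i) ⟩
            s * z i ∎)
        , 1# , s , λ i → refl)

-- The spectrum of H and the trace dichotomy

module SkewSpectrum {c ℓ : Level} (K : ACField c ℓ) where
  open Field K
  open LinearAlgebra K

  two : Carrier
  two = ι (+ 2)

  three : Carrier
  three = ι (+ 3)

  half : ∀ x → ∃ λ y → two * y ≈ x
  half x with inverse two (nat≉0 1)
  ... | i , 2i≈1 = i * x , trans (sym (*-assoc two i x)) (trans (*-congʳ 2i≈1) (*-identityˡ x))

  -- The involution h ↦ -1 - h

  reflect : Carrier → Carrier
  reflect h = - 1# - h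

  reflect-cong : ∀ {h k} → h ≈ k → reflect h ≈ reflect k
  reflect-cong e = +-congˡ (-‿cong e)

  reflect-swap : ∀ {h k} → reflect h ≈ k → h ≈ reflect k
  reflect-swap {h} e = trans
    (solve 1 (λ h → h := :- con (+ 1) :- (:- con (+ 1) :- h)) refl h) (reflect-cong e)

  -- For an eigenvector of H with zero sum and eigenvalue h, this is the eigenvalue of s D = 2 H + I
  -- - J. `reflect` changes its sign.
  odd : Carrier → Carrier
  odd h = two * h + 1#

  odd-injective : ∀ {h k} → odd h ≈ odd k → h ≈ k
  odd-injective {h} {k} e = *-cancelˡ (nat≉0 1) (begin
    two * h        ≈⟨ solve 1 (λ x → x := x :+ con (+ 1) :- con (+ 1)) refl (two * h) ⟩
    odd h - 1#     ≈⟨ +-congʳ e ⟩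
    odd k - 1#     ≈⟨ solve 1 (λ x → x := x :+ con (+ 1) :- con (+ 1)) refl (two * k) ⟨
    two * k        ∎)

  reflect-fixed : ∀ {h} → reflect h ≈ h → odd h ≈ 0#
  reflect-fixed {h} e = begin
    odd h          ≈⟨ solve 1 (λ h → con (+ 2) :* h :+ con (+ 1) := h :- (:- con (+ 1) :- h)) refl h ⟩
    h - reflect h  ≈⟨ x≈y⇒x-y≈0 (sym e) ⟩
    0#             ∎

  oddSquare : Carrier → Carrier
  oddSquare h = odd h * odd h

  oddSquare-cong : ∀ {h k} → h ≈ k → oddSquare h ≈ oddSquare k
  oddSquare-cong e = *-cong odd-cong odd-cong
    where odd-cong = +-congʳ (*-congˡ e)

  oddSquare-reflect : ∀ h → oddSquare (reflect h) ≈ oddSquare h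
  oddSquare-reflect h = solve 1 (λ h →
    let w = λ h → con (+ 2) :* h :+ con (+ 1) in
    w (:- con (+ 1) :- h) :* w (:- con (+ 1) :- h) := w h :* w h) refl h

  module Skew {n : ℕ} (D H : Matrix (suc n) (suc n)) (s : Carrier)
    (ss≈-3   : s * s ≈ - three)
    (skew    : ∀ u v → D v u ≈ - D u v)
    (rowSum  : ∀ u → sum (D u) ≈ 0#)
    (2H≈     : ∀ u v → two * H u v ≈ s * D u v + (1# - identity u v)) where

    m : Carrier
    m = nat (suc n)

    m≉0 : ¬ m ≈ 0#
    m≉0 = nat≉0 n

    -- By skewness the column sums of `D` vanish along with its row sums.
    sum-D⊛ : ∀ x → sum (D ⊛ x) ≈ 0#
    sum-D⊛ x = trans (sum-⊛ D x) (sum-zero (λ v → trans (*-congʳ (begin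
      sum (λ u → D u v)             ≈⟨ sum-cong (λ u → skew v u) ⟩
      sum (λ u → - D v u)
        ≈⟨ sum-cong (λ u → solve 1 (λ d → :- d := :- con (+ 1) :* d) refl (D v u)) ⟩
      sum (λ u → - 1# * D v u)      ≈⟨ *-distribˡ-sum (- 1#) (D v) ⟨
      - 1# * sum (D v)              ≈⟨ *-congˡ (rowSum v) ⟩
      - 1# * 0#                     ≈⟨ zeroʳ (- 1#) ⟩
      0#                            ∎)) (zeroˡ (x v))))

    -- The parameter `t` covers both `H`, with t = s, and its transpose, with t = -s.
    double-⊛ : ∀ t (A : Matrix (suc n) (suc n)) → (∀ u v → two * A u v ≈ t * D u v + (1# - identity u v)) →
               ∀ x u → two * (A ⊛ x) u ≈ t * (D ⊛ x) u + (sum x - x u)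
    double-⊛ t A 2A≈ x u = begin
      two * (A ⊛ x) u
        ≈⟨ scale-⊛ two A x u ⟨
      sum (λ v → two * A u v * x v)
        ≈⟨ sum-cong (λ v → trans (*-congʳ (2A≈ u v))
             (solve 4 (λ t d i x → (t :* d :+ (con (+ 1) :- i)) :* x
                  := (t :* (d :* x)) :+ (con (+ 1) :* x :+ :- con (+ 1) :* (i :* x)))
               refl t (D u v) (identity u v) (x v))) ⟩
      sum (λ v → t * (D u v * x v) + (1# * x v + - 1# * (identity u v * x v)))
        ≈⟨ ∑-distrib-+ (λ v → t * (D u v * x v)) (λ v → 1# * x v + - 1# * (identity u v * x v)) ⟩
      sum (λ v → t * (D u v * x v)) + sum (λ v → 1# * x v + - 1# * (identity u v * x v))
        ≈⟨ +-cong (sym (*-distribˡ-sum t (λ v → D u v * x v)))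
             (sum-linear 1# (- 1#) x (λ v → identity u v * x v)) ⟩
      t * (D ⊛ x) u + (1# * sum x + - 1# * (identity ⊛ x) u)
        ≈⟨ +-congˡ (+-congˡ (*-congˡ (⊛-identity x u))) ⟩
      t * (D ⊛ x) u + (1# * sum x + - 1# * x u)
        ≈⟨ +-congˡ (solve 2 (λ σ x → con (+ 1) :* σ :+ :- con (+ 1) :* x := σ :- x) refl (sum x) (x u)) ⟩
      t * (D ⊛ x) u + (sum x - x u) ∎

    double-H⊛ : ∀ x u → two * (H ⊛ x) u ≈ s * (D ⊛ x) u + (sum x - x u)
    double-H⊛ = double-⊛ s H 2H≈

    double-Hᵀ⊛ : ∀ x u → two * (transpose H ⊛ x) u ≈ - s * (D ⊛ x) u + (sum x - x u)
    double-Hᵀ⊛ = double-⊛ (- s) (transpose H) (λ u v → trans (2H≈ v u)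
      (+-cong (trans (*-congˡ (skew u v)) (solve 2 (λ s d → s :* :- d := :- s :* d) refl s (D u v)))
              (+-congˡ (-‿cong (reflexive (≡.cong ι (δ-symmetric v u)))))))

    module _ {x : Vector (suc n)} {t h : Carrier} (x≉0 : Nonzero x) (Σx≈0 : sum x ≈ 0#)
      (sDx≈tx : ∀ u → s * (D ⊛ x) u ≈ t * x u) (t≈ : odd h ≈ t) where

      balanced-eigenvector : Eigenvector H h x
      balanced-eigenvector = x≉0 , λ u → *-cancelˡ (nat≉0 1) (begin
        two * (H ⊛ x) u                  ≈⟨ double-H⊛ x u ⟩
        s * (D ⊛ x) u + (sum x - x u)    ≈⟨ +-cong (trans (sDx≈tx u) (*-congʳ (sym t≈))) (+-congʳ Σx≈0) ⟩
        odd h * x u + (0# - x u)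
          ≈⟨ solve 2 (λ h x → (con (+ 2) :* h :+ con (+ 1)) :* x :+ (con (+ 0) :- x) := con (+ 2) :* (h :* x))
               refl h (x u) ⟩
        two * (h * x u)                  ∎)

      balanced-eigenvectorᵀ : Eigenvector (transpose H) (reflect h) x
      balanced-eigenvectorᵀ = x≉0 , λ u → *-cancelˡ (nat≉0 1) (begin
        two * (transpose H ⊛ x) u          ≈⟨ double-Hᵀ⊛ x u ⟩
        - s * (D ⊛ x) u + (sum x - x u)
          ≈⟨ +-cong (trans (sym (-‿distribˡ-* s _)) (-‿cong (trans (sDx≈tx u) (*-congʳ (sym t≈)))))
               (+-congʳ Σx≈0) ⟩
        - (odd h * x u) + (0# - x u)
          ≈⟨ solve 2 (λ h x → :- ((con (+ 2) :* h :+ con (+ 1)) :* x) :+ (con (+ 0) :- x)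
               := con (+ 2) :* ((:- con (+ 1) :- h) :* x)) refl h (x u) ⟩
        two * (reflect h * x u)            ∎)

    -- Holds when h has an eigenvector of zero sum, yet refers only to the spectrum of `H`, so it
    -- can be tested against the list of three eigenvalues.
    Reflected : Carrier → Set (c ⊔ ℓ)
    Reflected h = Eigenvalue H h × Eigenvalue H (reflect h)

    -- On vectors of zero sum, -3 D² = (s D)² = (2 H + I)².
    reflected-of-square : ∀ {x r} → Nonzero x → sum x ≈ 0# → (∀ u → - three * (D ⊛ D ⊛ x) u ≈ r * x u) →
                          ¬ ¬ ∃ λ h → Reflected h × oddSquare h ≈ r
    reflected-of-square {x} {r} x≉0 Σx≈0 -3DDx≈rx = do
      t , tt≈r , z , (z≉0 , Mz≈tz) , a , b , z≈ ← eigenvector-of-square M r x x≉0 MMx≈rx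
      let h , 2h≈t-1 = half (t - 1#)
          odd≈t : odd h ≈ t
          odd≈t = trans (+-congʳ 2h≈t-1) (solve 1 (λ t → t :- con (+ 1) :+ con (+ 1) := t) refl t)
          Σz≈0 : sum z ≈ 0#
          Σz≈0 = begin
            sum z                                ≈⟨ sum-cong z≈ ⟩
            sum (λ u → a * (M ⊛ x) u + b * x u)  ≈⟨ sum-linear a b (M ⊛ x) x ⟩
            a * sum (M ⊛ x) + b * sum x          ≈⟨ +-cong (*-congˡ (sum-M⊛ x)) (*-congˡ Σx≈0) ⟩
            a * 0# + b * 0#
              ≈⟨ solve 2 (λ a b → a :* con (+ 0) :+ b :* con (+ 0) := con (+ 0)) refl a b ⟩
            0#                                   ∎
          sDz≈tz : ∀ u → s * (D ⊛ z) u ≈ t * z u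
          sDz≈tz u = trans (sym (scale-⊛ s D z u)) (Mz≈tz u)
      reflected ← transpose-eigenvalue H (z , balanced-eigenvectorᵀ z≉0 Σz≈0 sDz≈tz odd≈t)
      pure (h , ((z , balanced-eigenvector z≉0 Σz≈0 sDz≈tz odd≈t) , reflected)
        , trans (*-cong odd≈t odd≈t) tt≈r)
      where
      M : Matrix (suc n) (suc n)
      M u v = s * D u v

      MMx≈rx : ∀ u → (M ⊛ M ⊛ x) u ≈ r * x u
      MMx≈rx u = begin
        (M ⊛ M ⊛ x) u                      ≈⟨ scale-⊛ s D (M ⊛ x) u ⟩
        s * (D ⊛ M ⊛ x) u                  ≈⟨ *-congˡ (⊛-congˡ D (scale-⊛ s D x) u) ⟩
        s * (D ⊛ (λ v → s * (D ⊛ x) v)) u  ≈⟨ *-congˡ (⊛-scale D s (D ⊛ x) u) ⟩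
        s * (s * (D ⊛ D ⊛ x) u)            ≈⟨ trans (sym (*-assoc s s _)) (*-congʳ ss≈-3) ⟩
        - three * (D ⊛ D ⊛ x) u            ≈⟨ -3DDx≈rx u ⟩
        r * x u                            ∎

      sum-M⊛ : ∀ x → sum (M ⊛ x) ≈ 0#
      sum-M⊛ x = begin
        sum (M ⊛ x)                ≈⟨ sum-cong (scale-⊛ s D x) ⟩
        sum (λ u → s * (D ⊛ x) u)  ≈⟨ *-distribˡ-sum s (D ⊛ x) ⟨
        s * sum (D ⊛ x)            ≈⟨ *-congˡ (sum-D⊛ x) ⟩
        s * 0#                     ≈⟨ zeroʳ s ⟩
        0#                         ∎

    -- The degree, and the symmetry of the other eigenvalues

    degree : Carrier
    degree = proj₁ (half (m - 1#))

    odd-degree : odd degree ≈ m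
    odd-degree = trans (+-congʳ (proj₂ (half (m - 1#)))) (solve 1 (λ m → m :- con (+ 1) :+ con (+ 1) := m)
         refl m)

    degree-eigenvalue : Eigenvalue H degree
    degree-eigenvalue = (λ _ → 1#) , (zero , nontrivial) , λ u → *-cancelˡ (nat≉0 1) (begin
      two * (H ⊛ (λ _ → 1#)) u
        ≈⟨ double-H⊛ (λ _ → 1#) u ⟩
      s * (D ⊛ (λ _ → 1#)) u + (sum {suc n} (λ _ → 1#) - 1#)
        ≈⟨ +-cong (*-congˡ (trans (sum-cong (λ v → *-identityʳ (D u v))) (rowSum u)))
             (+-congʳ (sum-const (suc n) 1#)) ⟩
      s * 0# + (m * 1# - 1#)
        ≈⟨ solve 2 (λ s m → s :* con (+ 0) :+ (m :* con (+ 1) :- con (+ 1)) := m :- con (+ 1)) refl s m ⟩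
      m - 1#
        ≈⟨ trans (*-congˡ (*-identityʳ _)) (proj₂ (half (m - 1#))) ⟨
      two * (degree * 1#) ∎)

    -- Summing the coordinates of 2 H x = s D x + (J - I) x gives (2h + 1 - m) Σx = 0, and 2h + 1 =
    -- m only for the degree.
    sum≈0-of-eigenvector : ∀ {h x} → Eigenvector H h x → ¬ h ≈ degree → sum x ≈ 0#
    sum≈0-of-eigenvector {h} {x} (_ , Hx≈hx) h≉d =
      *-cancelˡ-0 (λ e → h≉d (odd-injective (trans (x-y≈0⇒x≈y e) (sym odd-degree)))) (begin
        (odd h - m) * sum x
          ≈⟨ solve 3 (λ h m σ → (con (+ 2) :* h :+ con (+ 1) :- m) :* σ
               := con (+ 2) :* (h :* σ) :- (m :* σ :- σ)) refl h m (sum x) ⟩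
        two * (h * sum x) - (m * sum x - sum x)
          ≈⟨ x≈y⇒x-y≈0 (begin
               two * (h * sum x)
                 ≈⟨ *-congˡ (trans (*-distribˡ-sum h x) (sum-cong (λ u → sym (Hx≈hx u)))) ⟩
               two * sum (H ⊛ x)
                 ≈⟨ trans (*-distribˡ-sum two (H ⊛ x)) (sum-cong (double-H⊛ x)) ⟩
               sum (λ u → s * (D ⊛ x) u + (sum x - x u))
                 ≈⟨ sum-cong (λ u → solve 4 (λ s d σ x → s :* d :+ (σ :- x) := s :* d :+ con (+ 1) :* (σ :- x))
                      refl s ((D ⊛ x) u) (sum x) (x u)) ⟩
               sum (λ u → s * (D ⊛ x) u + 1# * (sum x - x u))
                 ≈⟨ sum-linear s 1# (D ⊛ x) (λ u → sum x - x u) ⟩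
               s * sum (D ⊛ x) + 1# * sum (λ u → sum x - x u)
                 ≈⟨ +-cong (*-congˡ (sum-D⊛ x)) (*-congˡ (trans
                      (sum-cong (λ u → solve 2 (λ σ x → σ :- x := con (+ 1) :* σ :+ :- con (+ 1) :* x)
                           refl (sum x) (x u)))
                      (sum-linear 1# (- 1#) (λ _ → sum x) x))) ⟩
               s * 0# + 1# * (1# * sum {suc n} (λ _ → sum x) + - 1# * sum x)
                 ≈⟨ +-congˡ (*-congˡ (+-congʳ (*-congˡ (sum-const (suc n) (sum x))))) ⟩
               s * 0# + 1# * (1# * (m * sum x) + - 1# * sum x)
                 ≈⟨ solve 3 (λ s m σ → s :* con (+ 0) :+ con (+ 1) :* (con (+ 1) :* (m :* σ) :+ :- con (+ 1) :* σ)
                      := m :* σ :- σ) refl s m (sum x) ⟩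
               m * sum x - sum x ∎) ⟩
        0# ∎)

    reflect-eigenvalue : ∀ {h} → Eigenvalue H h → ¬ h ≈ degree → ¬ ¬ Eigenvalue H (reflect h)
    reflect-eigenvalue {h} (x , x≉0 , Hx≈hx) h≉d =
      transpose-eigenvalue H (x , balanced-eigenvectorᵀ x≉0 Σx≈0 (λ u → begin
        s * (D ⊛ x) u
          ≈⟨ solve 2 (λ e x → e := e :+ (con (+ 0) :- x) :+ x) refl _ (x u) ⟩
        s * (D ⊛ x) u + (0# - x u) + x u              ≈⟨ +-congʳ (+-congˡ (+-congʳ Σx≈0)) ⟨
        s * (D ⊛ x) u + (sum x - x u) + x u           ≈⟨ +-congʳ (double-H⊛ x u) ⟨
        two * (H ⊛ x) u + x u                         ≈⟨ +-congʳ (*-congˡ (Hx≈hx u)) ⟩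
        two * (h * x u) + x u
          ≈⟨ solve 2 (λ h x → con (+ 2) :* (h :* x) :+ x := (con (+ 2) :* h :+ con (+ 1)) :* x) refl h (x u) ⟩
        odd h * x u                                   ∎) refl)
      where
      Σx≈0 : sum x ≈ 0#
      Σx≈0 = sum≈0-of-eigenvector (x≉0 , Hx≈hx) h≉d

    -- The two possible shapes of the spectrum

    OneSquare : Set (c ⊔ ℓ)
    OneSquare = ∃ λ κ → ∀ h → Reflected h → oddSquare h ≈ κ

    ZeroOrOrderSquare : Set (c ⊔ ℓ)
    ZeroOrOrderSquare = ∀ h → Reflected h → oddSquare h ≈ 0# ⊎ oddSquare h ≈ m * m

    -- reflect permutes the eigenvalues of H except perhaps the degree, so either it
    -- swaps l₂ and l₃, or it fixes one of them and sends the other to the degree.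
    module Classification {l₂ l₃ : Carrier} (l₂≉d : ¬ l₂ ≈ degree) (l₃≉d : ¬ l₃ ≈ degree) (l₂≉l₃ : ¬ l₂ ≈ l₃)
      (e₂ : Eigenvalue H l₂) (e₃ : Eigenvalue H l₃)
      (spec : ∀ h → Eigenvalue H h → h ≈ degree ⊎ h ≈ l₂ ⊎ h ≈ l₃) where

      -- The degree cannot be `Reflected` here: being its own reflection would give m = 0, and
      -- reflecting to l₂ or l₃ would make it equal to l₃ or l₂.
      swapped : reflect l₂ ≈ l₃ → OneSquare
      swapped ρl₂≈l₃ = oddSquare l₂ , λ h (e , e′) → case (spec h e) (spec (reflect h) e′)
        where
        l₃≈ρl₂ = sym ρl₂≈l₃
        case : ∀ {h} → h ≈ degree ⊎ h ≈ l₂ ⊎ h ≈ l₃ → reflect h ≈ degree ⊎ reflect h ≈ l₂ ⊎ reflect h ≈ l₃ →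
               oddSquare h ≈ oddSquare l₂
        case (inj₂ (inj₁ h≈l₂)) _ = oddSquare-cong h≈l₂
        case (inj₂ (inj₂ h≈l₃)) _ = trans (oddSquare-cong (trans h≈l₃ l₃≈ρl₂)) (oddSquare-reflect l₂)
        case (inj₁ h≈d) (inj₁ ρh≈d) = ⊥-elim (m≉0 (trans (sym odd-degree)
          (reflect-fixed (trans (reflect-cong (sym h≈d)) ρh≈d))))
        case (inj₁ h≈d) (inj₂ (inj₁ ρh≈l₂)) =
          ⊥-elim (l₃≉d (trans l₃≈ρl₂ (trans (sym (reflect-swap ρh≈l₂)) h≈d)))
        case (inj₁ h≈d) (inj₂ (inj₂ ρh≈l₃)) =
          ⊥-elim (l₂≉d (trans (reflect-swap ρl₂≈l₃) (trans (sym (reflect-swap ρh≈l₃)) h≈d)))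

      -- The values of `odd` at the degree, p and q are m, 0 and -m.
      fixed : ∀ {p q} → reflect p ≈ p → reflect q ≈ degree →
              (∀ h → Eigenvalue H h → h ≈ degree ⊎ h ≈ p ⊎ h ≈ q) → ZeroOrOrderSquare
      fixed {p} {q} ρp≈p ρq≈d spec h (e , _) with spec h e
      ... | inj₁ h≈d        = inj₂ (trans (oddSquare-cong h≈d) (*-cong odd-degree odd-degree))
      ... | inj₂ (inj₁ h≈p) = inj₁ (trans (oddSquare-cong h≈p) (trans (*-congˡ (reflect-fixed ρp≈p)) (zeroʳ _)))
      ... | inj₂ (inj₂ h≈q) = inj₂ (trans (oddSquare-cong h≈q) (trans (sym (oddSquare-reflect q))
        (trans (oddSquare-cong ρq≈d) (*-cong odd-degree odd-degree))))

      classification : ¬ ¬ (OneSquare ⊎ ZeroOrOrderSquare)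
      classification = do
        e₂′ ← reflect-eigenvalue e₂ l₂≉d
        e₃′ ← reflect-eigenvalue e₃ l₃≉d
        pure (case (spec (reflect l₂) e₂′) (spec (reflect l₃) e₃′))
        where
        case : reflect l₂ ≈ degree ⊎ reflect l₂ ≈ l₂ ⊎ reflect l₂ ≈ l₃ →
               reflect l₃ ≈ degree ⊎ reflect l₃ ≈ l₂ ⊎ reflect l₃ ≈ l₃ → OneSquare ⊎ ZeroOrOrderSquare
        case (inj₂ (inj₂ ρl₂≈l₃)) _ = inj₁ (swapped ρl₂≈l₃)
        case (inj₂ (inj₁ ρl₂≈l₂)) (inj₁ ρl₃≈d) = inj₂ (fixed ρl₂≈l₂ ρl₃≈d spec)
        case (inj₂ (inj₁ ρl₂≈l₂)) (inj₂ (inj₁ ρl₃≈l₂)) =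
          ⊥-elim (l₂≉l₃ (trans (sym ρl₂≈l₂) (sym (reflect-swap ρl₃≈l₂))))
        -- The involution has the single fixed point -1/2.
        case (inj₂ (inj₁ ρl₂≈l₂)) (inj₂ (inj₂ ρl₃≈l₃)) =
          ⊥-elim (l₂≉l₃ (odd-injective (trans (reflect-fixed ρl₂≈l₂) (sym (reflect-fixed ρl₃≈l₃)))))
        case (inj₁ ρl₂≈d) (inj₁ ρl₃≈d) =
          ⊥-elim (l₂≉l₃ (trans (reflect-swap ρl₂≈d) (sym (reflect-swap ρl₃≈d))))
        case (inj₁ ρl₂≈d) (inj₂ (inj₁ ρl₃≈l₂)) =
          ⊥-elim (l₃≉d (trans (reflect-swap ρl₃≈l₂) ρl₂≈d))
        case (inj₁ ρl₂≈d) (inj₂ (inj₂ ρl₃≈l₃)) = inj₂ (fixed ρl₃≈l₃ ρl₂≈d (λ h e → swap (spec h e)))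
          where
          swap : ∀ {h} → h ≈ degree ⊎ h ≈ l₂ ⊎ h ≈ l₃ → h ≈ degree ⊎ h ≈ l₃ ⊎ h ≈ l₂
          swap (inj₁ p)        = inj₁ p
          swap (inj₂ (inj₁ p)) = inj₂ (inj₂ p)
          swap (inj₂ (inj₂ p)) = inj₂ (inj₁ p)

    -- The trace of -3 D² = (s D)²

    gram : Matrix (suc n) (suc n)
    gram u v = - three * (D ⊗ D) u v

    gram-⊛ : ∀ x u → (gram ⊛ x) u ≈ - three * (D ⊛ D ⊛ x) u
    gram-⊛ x u = trans (scale-⊛ (- three) (D ⊗ D) x u) (*-congˡ (⊛-⊗ D D x u))

    -- The column sums of `gram` vanish, so an eigenvector has eigenvalue 0 or zero sum; in the
    -- latter case its eigenvalue is an `oddSquare`. The trace then counts with `j` the summands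
    -- equal to m².
    trace-gram : ZeroOrOrderSquare → ¬ ¬ ∃ λ j → trace gram ≈ nat j * (m * m)
    trace-gram squares = do
      f , f∈ , tr ← trace-eigenvalues (λ r → r ≈ 0# ⊎ r ≈ m * m) gram spec
      let j , Σf≈ = sum-two-valued f f∈
      pure (j , trans tr Σf≈)
      where
      spec : ∀ {r} → Eigenvalue gram r → ¬ ¬ (r ≈ 0# ⊎ r ≈ m * m)
      spec {r} (x , x≉0 , Gx≈rx) = do
        inj₂ Σx≈0 ← zero-product (begin
            r * sum x
              ≈⟨ trans (*-distribˡ-sum r x) (sum-cong (λ u → sym (Gx≈rx u))) ⟩
            sum (gram ⊛ x)                         ≈⟨ sum-cong (gram-⊛ x) ⟩
            sum (λ u → - three * (D ⊛ D ⊛ x) u)    ≈⟨ *-distribˡ-sum (- three) (D ⊛ D ⊛ x) ⟨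
            - three * sum (D ⊛ D ⊛ x)              ≈⟨ trans (*-congˡ (sum-D⊛ (D ⊛ x))) (zeroʳ (- three)) ⟩
            0#                                     ∎)
          where inj₁ r≈0 → pure (inj₁ r≈0)
        h , reflected , q≈r ← reflected-of-square x≉0 Σx≈0 (λ u → trans (sym (gram-⊛ x u)) (Gx≈rx u))
        pure (transport q≈r (squares h reflected))
        where
        transport : ∀ {q r} → q ≈ r → q ≈ 0# ⊎ q ≈ m * m → r ≈ 0# ⊎ r ≈ m * m
        transport q≈r (inj₁ q≈0)  = inj₁ (trans (sym q≈r) q≈0)
        transport q≈r (inj₂ q≈mm) = inj₂ (trans (sym q≈r) q≈mm)

      sum-two-valued : ∀ {k y} (f : Vector k) → (∀ i → f i ≈ 0# ⊎ f i ≈ y) → ∃ λ j → sum f ≈ nat j * y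
      sum-two-valued {zero}  {y} f f∈ = 0 , sym (zeroˡ y)
      sum-two-valued {suc k} {y} f f∈ with f∈ zero | sum-two-valued (f ∘ suc) (f∈ ∘ suc)
      ... | inj₁ f₀≈0 | j , Σ≈ = j , trans (+-cong f₀≈0 Σ≈) (+-identityˡ _)
      ... | inj₂ f₀≈y | j , Σ≈ = suc j , trans (+-cong f₀≈y Σ≈)
        (trans (solve 2 (λ y j → y :+ j :* y := (con (+ 1) :+ j) :* y)
             refl y (nat j)) (*-congʳ (sym (nat-suc j))))

    -- D² + m I - J, whose vanishing makes the bordered matrix Hadamard
    defect : Matrix (suc n) (suc n)
    defect u v = (D ⊗ D) u v + (m * identity u v + - 1#)

    defect-⊛ : ∀ x u → (defect ⊛ x) u ≈ (D ⊛ D ⊛ x) u + (m * x u - sum x)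
    defect-⊛ x u = begin
      (defect ⊛ x) u
        ≈⟨ +-⊛ (D ⊗ D) (λ u v → m * identity u v + - 1#) x u ⟩
      ((D ⊗ D) ⊛ x) u + ((λ u v → m * identity u v + - 1#) ⊛ x) u
        ≈⟨ +-cong (⊛-⊗ D D x u) (+-⊛ (λ u v → m * identity u v) (λ _ _ → - 1#) x u) ⟩
      (D ⊛ D ⊛ x) u + (((λ u v → m * identity u v) ⊛ x) u + sum (λ v → - 1# * x v))
        ≈⟨ +-congˡ (+-cong (trans (scale-⊛ m identity x u) (*-congˡ (⊛-identity x u)))
             (trans (sym (*-distribˡ-sum (- 1#) x)) (solve 1 (λ σ → :- con (+ 1) :* σ := :- σ)
                  refl (sum x)))) ⟩
      (D ⊛ D ⊛ x) u + (m * x u - sum x) ∎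

    -- D² contributes nothing to the sum, and m I and J contribute m Σx each.
    sum-defect⊛ : ∀ x → sum (defect ⊛ x) ≈ 0#
    sum-defect⊛ x = begin
      sum (defect ⊛ x)
        ≈⟨ sum-cong (λ u → trans (defect-⊛ x u) (solve 4 (λ d m x σ → d :+ (m :* x :- σ)
             := con (+ 1) :* d :+ con (+ 1) :* (m :* x :+ :- con (+ 1) :* σ)) refl _ m (x u) (sum x))) ⟩
      sum (λ u → 1# * (D ⊛ D ⊛ x) u + 1# * (m * x u + - 1# * sum x))
        ≈⟨ sum-linear 1# 1# (D ⊛ D ⊛ x) (λ u → m * x u + - 1# * sum x) ⟩
      1# * sum (D ⊛ D ⊛ x) + 1# * sum (λ u → m * x u + - 1# * sum x)
        ≈⟨ +-cong (*-congˡ (sum-D⊛ (D ⊛ x))) (*-congˡ (trans (sum-linear m (- 1#) x (λ _ → sum x))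
             (+-congˡ (*-congˡ (sum-const (suc n) (sum x)))))) ⟩
      1# * 0# + 1# * (m * sum x + - 1# * (m * sum x))
        ≈⟨ solve 2 (λ m σ → con (+ 1) :* con (+ 0) :+ con (+ 1) :* (m :* σ :+ :- con (+ 1) :* (m :* σ))
             := con (+ 0)) refl m (sum x) ⟩
      0# ∎

    module DefectSpectrum {κ : Carrier} (square≈κ : ∀ h → Reflected h → oddSquare h ≈ κ) where

      -- The only eigenvalue of the defect on vectors of zero sum.
      root : Carrier
      root = m - proj₁ (inverse three (nat≉0 2)) * κ

      three-root : three * root ≈ three * m - κ
      three-root = let i , 3i≈1 = inverse three (nat≉0 2) in begin
        three * (m - i * κ)
          ≈⟨ solve 3 (λ m i κ → con (+ 3) :* (m :- i :* κ) := con (+ 3) :* m :- con (+ 3) :* i :* κ)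
               refl m i κ ⟩
        three * m - three * i * κ    ≈⟨ +-congˡ (-‿cong (trans (*-congʳ 3i≈1) (*-identityˡ κ))) ⟩
        three * m - κ                ∎

      -- On vectors of zero sum the defect is D² + m I, so -3 D² has the eigenvalue 3m - 3r, which
      -- must be κ.
      defect-eigenvalue : ∀ {r x} → Eigenvector defect r x → sum x ≈ 0# → ¬ ¬ r ≈ root
      defect-eigenvalue {r} {x} (x≉0 , Qx≈rx) Σx≈0 = do
        h , reflected , q≈ ← reflected-of-square x≉0 Σx≈0 (λ u → begin
          - three * (D ⊛ D ⊛ x) u
            ≈⟨ solve 3 (λ d m x → :- con (+ 3) :* d := :- con (+ 3) :* (d :+ (m :* x :- con (+ 0)) :- m :* x))
                 refl _ m (x u) ⟩
          - three * ((D ⊛ D ⊛ x) u + (m * x u - 0#) - m * x u)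
            ≈⟨ *-congˡ (+-congʳ (trans (+-congˡ (+-congˡ (-‿cong (sym Σx≈0))))
                 (trans (sym (defect-⊛ x u)) (Qx≈rx u)))) ⟩
          - three * (r * x u - m * x u)
            ≈⟨ solve 3 (λ r m x → :- con (+ 3) :* (r :* x :- m :* x) := (con (+ 3) :* m :- con (+ 3) :* r) :* x)
                 refl r m (x u) ⟩
          (three * m - three * r) * x u ∎)
        pure (*-cancelˡ (nat≉0 2) (begin
          three * r
            ≈⟨ solve 2 (λ a b → b := a :- (a :- b)) refl (three * m) (three * r) ⟩
          three * m - (three * m - three * r)
            ≈⟨ +-congˡ (-‿cong (trans (sym q≈) (square≈κ h reflected))) ⟩
          three * m - κ
            ≈⟨ three-root ⟨
          three * root ∎))

      -- Shifting the defect by a multiple of the all-ones matrix moves the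
      -- eigenvalue of the constant vectors to the root as well.
      root-of-trace : trace defect ≈ 0# → ¬ ¬ ((m - 1#) * root ≈ 0#)
      root-of-trace tr≈0 = do
        f , f≈ , tr ← trace-eigenvalues (_≈ root) M spec
        -- All m summands are `root`, whereas the trace of `M` is 0 + m t = `root`.
        pure (begin
          (m - 1#) * root
            ≈⟨ solve 2 (λ m c → (m :- con (+ 1)) :* c := m :* c :- c) refl m root ⟩
          m * root - root                    ≈⟨ x≈y⇒x-y≈0 (begin
            m * root                           ≈⟨ sum-const (suc n) root ⟨
            sum {suc n} (λ _ → root)           ≈⟨ sum-cong f≈ ⟨
            sum f                              ≈⟨ tr ⟨
            trace M                            ≈⟨ ∑-distrib-+ (λ u → defect u u) (λ _ → t) ⟩
            trace defect + sum {suc n} (λ _ → t) ≈⟨ +-cong tr≈0 (trans (sum-const (suc n) t) mt≈root) ⟩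
            0# + root                          ≈⟨ +-identityˡ root ⟩
            root                               ∎) ⟩
          0#                                 ∎)
        where
        t : Carrier
        t = proj₁ (inverse m m≉0) * root

        mt≈root : m * t ≈ root
        mt≈root = trans (sym (*-assoc m _ root)) (trans (*-congʳ (proj₂ (inverse m m≉0))) (*-identityˡ root))

        M : Matrix (suc n) (suc n)
        M u v = defect u v + t

        M-⊛ : ∀ x u → (M ⊛ x) u ≈ (defect ⊛ x) u + t * sum x
        M-⊛ x u = trans (+-⊛ defect (λ _ _ → t) x u) (+-congˡ (sym (*-distribˡ-sum t x)))

        spec : ∀ {r} → Eigenvalue M r → ¬ ¬ r ≈ root
        spec {r} (x , x≉0 , Mx≈rx) = do
          -- The column sums of `M` are m t = `root`, so summing M x = r x gives (r - root) Σx = 0.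
          inj₂ Σx≈0 ← zero-product (begin
              (r - root) * sum x
                ≈⟨ solve 3 (λ r c σ → (r :- c) :* σ := r :* σ :- c :* σ) refl r root (sum x) ⟩
              r * sum x - root * sum x        ≈⟨ x≈y⇒x-y≈0 (begin
                r * sum x
                  ≈⟨ trans (*-distribˡ-sum r x) (sum-cong (λ u → sym (Mx≈rx u))) ⟩
                sum (M ⊛ x)                     ≈⟨ sum-cong (M-⊛ x) ⟩
                sum (λ u → (defect ⊛ x) u + t * sum x) ≈⟨ ∑-distrib-+ (defect ⊛ x) (λ _ → t * sum x) ⟩
                sum (defect ⊛ x) + sum {suc n} (λ _ → t * sum x)
                  ≈⟨ +-cong (sum-defect⊛ x) (sum-const (suc n) (t * sum x)) ⟩
                0# + m * (t * sum x)
                  ≈⟨ trans (+-identityˡ _) (trans (sym (*-assoc m t _)) (*-congʳ mt≈root)) ⟩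
                root * sum x                    ∎) ⟩
              0#                              ∎)
            where inj₁ r-root≈0 → pure (x-y≈0⇒x≈y r-root≈0)
          defect-eigenvalue (x≉0 , λ u → begin
            (defect ⊛ x) u                ≈⟨ +-identityʳ _ ⟨
            (defect ⊛ x) u + 0#           ≈⟨ +-congˡ (trans (*-congˡ Σx≈0) (zeroʳ t)) ⟨
            (defect ⊛ x) u + t * sum x    ≈⟨ M-⊛ x u ⟨
            (M ⊛ x) u                     ≈⟨ Mx≈rx u ⟩
            r * x u                       ∎) Σx≈0

      -- An eigenvalue of the squared defect is s² for an eigenvalue s of the defect. Vanishing
      -- column sums give s = 0 or an eigenvector of zero sum, and in the second case s = `root` =
      -- 0.
      trace-defect² : root ≈ 0# → ¬ ¬ trace (defect ⊗ defect) ≈ 0#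
      trace-defect² root≈0 = do
        f , f≈0 , tr ← trace-eigenvalues (_≈ 0#) (defect ⊗ defect) spec
        pure (trans tr (sum-zero f≈0))
        where
        spec : ∀ {r} → Eigenvalue (defect ⊗ defect) r → ¬ ¬ r ≈ 0#
        spec {r} (x , x≉0 , QQx≈rx) = do
          s , ss≈r , z , (z≉0 , Qz≈sz) , _ ← eigenvector-of-square defect r x x≉0
            (λ u → trans (sym (⊛-⊗ defect defect x u)) (QQx≈rx u))
          let r≈0 : s ≈ 0# → r ≈ 0#
              r≈0 s≈0 = trans (sym ss≈r) (trans (*-congˡ s≈0) (zeroʳ s))
          inj₂ Σz≈0 ← zero-product (trans (*-distribˡ-sum s z)
              (trans (sum-cong (λ u → sym (Qz≈sz u))) (sum-defect⊛ z)))
            where inj₁ s≈0 → pure (r≈0 s≈0)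
          s≈root ← defect-eigenvalue (z≉0 , Qz≈sz) Σz≈0
          pure (r≈0 (trans s≈root root≈0))

    -- The degree is one of the three eigenvalues, and the other two are classified. Every outcome
    -- will be an equation between images of integers, so it can be pulled back from the field.
    trace-dichotomy : ∀ {l₁ l₂ l₃} → ¬ l₁ ≈ l₂ → ¬ l₁ ≈ l₃ → ¬ l₂ ≈ l₃ →
      Eigenvalue H l₁ → Eigenvalue H l₂ → Eigenvalue H l₃ →
      (∀ h → Eigenvalue H h → h ≈ l₁ ⊎ h ≈ l₂ ⊎ h ≈ l₃) → trace defect ≈ 0# →
      ¬ ¬ ((∃ λ j → trace gram ≈ nat j * (m * m)) ⊎ m - 1# ≈ 0# ⊎ trace (defect ⊗ defect) ≈ 0#)
    trace-dichotomy {l₁} {l₂} {l₃} l₁≉l₂ l₁≉l₃ l₂≉l₃ e₁ e₂ e₃ spec tr≈0 =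
      classified (spec degree degree-eigenvalue) >>= λ where
        (inj₁ (κ , square≈κ)) → do
          inj₂ root≈0 ← DefectSpectrum.root-of-trace square≈κ tr≈0 >>= zero-product
            where inj₁ m≈1 → pure (inj₂ (inj₁ m≈1))
          tr²≈0 ← DefectSpectrum.trace-defect² square≈κ root≈0
          pure (inj₂ (inj₂ tr²≈0))
        (inj₂ squares) → do
          result ← trace-gram squares
          pure (inj₁ result)
      where
      classified : degree ≈ l₁ ⊎ degree ≈ l₂ ⊎ degree ≈ l₃ →
        ¬ ¬ (OneSquare ⊎ ZeroOrOrderSquare)
      classified (inj₁ d≈l₁) = Classification.classification
        (λ e → l₁≉l₂ (sym (trans e d≈l₁))) (λ e → l₁≉l₃ (sym (trans e d≈l₁))) l₂≉l₃ e₂ e₃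
        (λ h e → rotate (spec h e))
        where
        rotate : ∀ {h} → h ≈ l₁ ⊎ h ≈ l₂ ⊎ h ≈ l₃ → h ≈ degree ⊎ h ≈ l₂ ⊎ h ≈ l₃
        rotate (inj₁ p) = inj₁ (trans p (sym d≈l₁))
        rotate (inj₂ p) = inj₂ p
      classified (inj₂ (inj₁ d≈l₂)) = Classification.classification
        (λ e → l₁≉l₂ (trans e d≈l₂)) (λ e → l₂≉l₃ (sym (trans e d≈l₂))) l₁≉l₃ e₁ e₃ (λ h e → rotate (spec h e))
        where
        rotate : ∀ {h} → h ≈ l₁ ⊎ h ≈ l₂ ⊎ h ≈ l₃ → h ≈ degree ⊎ h ≈ l₁ ⊎ h ≈ l₃
        rotate (inj₁ p)        = inj₂ (inj₁ p)
        rotate (inj₂ (inj₁ p)) = inj₁ (trans p (sym d≈l₂))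
        rotate (inj₂ (inj₂ p)) = inj₂ (inj₂ p)
      classified (inj₂ (inj₂ d≈l₃)) = Classification.classification
        (λ e → l₁≉l₃ (trans e d≈l₃)) (λ e → l₂≉l₃ (trans e d≈l₃)) l₁≉l₂ e₁ e₂ (λ h e → rotate (spec h e))
        where
        rotate : ∀ {h} → h ≈ l₁ ⊎ h ≈ l₂ ⊎ h ≈ l₃ → h ≈ degree ⊎ h ≈ l₁ ⊎ h ≈ l₂
        rotate (inj₁ p)        = inj₂ (inj₁ p)
        rotate (inj₂ (inj₁ p)) = inj₂ (inj₂ p)
        rotate (inj₂ (inj₂ p)) = inj₁ (trans p (sym d≈l₃))

-- Integer matrices of a regular tournament

module ℤSum where
  open Algebra.Properties.Semiring.Sum ℤₚ.+-*-semiring public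

  sumℤ≡sum : ∀ {n} (f : Fin n → ℤ) → sumℤ n f ≡ sum f
  sumℤ≡sum {zero}  f = ≡.refl
  sumℤ≡sum {suc n} f = ≡.cong (ℤ._+_ (f zero)) (sumℤ≡sum (f ∘ suc))

  sum-const : ∀ n c → sum {n} (λ _ → c) ≡ + n ℤ.* c
  sum-const zero    c = ≡.sym (ℤₚ.*-zeroˡ c)
  sum-const (suc n) c = ≡.trans (≡.cong (ℤ._+_ c) (sum-const n c)) (≡.sym (ℤₚ.suc-* (+ n) c))

  sum-neg : ∀ {n} (f : Fin n → ℤ) → sum (λ i → ℤ.- f i) ≡ ℤ.- sum f
  sum-neg {zero}  f = ≡.refl
  sum-neg {suc n} f = ≡.trans (≡.cong (ℤ._+_ (ℤ.- f zero)) (sum-neg (f ∘ suc)))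
    (≡.sym (ℤₚ.neg-distrib-+ (f zero) _))

  sum-δ : ∀ {n} (i : Fin n) (f : Fin n → ℤ) → sum (λ k → δ i k ℤ.* f k) ≡ f i
  sum-δ {suc n} zero f = ≡.trans
    (≡.cong₂ ℤ._+_ (ℤₚ.*-identityˡ (f zero)) (sum-replicate-zero n)) (ℤₚ.+-identityʳ (f zero))
  sum-δ (suc i) f = ≡.trans (ℤₚ.+-identityˡ _) (sum-δ i (f ∘ suc))

  sum-δ-one : ∀ {n} (i : Fin n) → sum (δ i) ≡ + 1
  sum-δ-one i = ≡.trans (sum-cong-≗ (λ k → ≡.sym (ℤₚ.*-identityʳ (δ i k)))) (sum-δ i (λ _ → + 1))

  0≤i*i : ∀ i → + 0 ℤ.≤ i ℤ.* i
  0≤i*i (+ n)    = ≡.subst (+ 0 ℤ.≤_) (ℤₚ.pos-* n n) (ℤ.+≤+ ℕ.z≤n)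
  0≤i*i -[1+ n ] = ℤ.+≤+ ℕ.z≤n

  sum-nonneg : ∀ {n} (f : Fin n → ℤ) → (∀ i → + 0 ℤ.≤ f i) → + 0 ℤ.≤ sum f
  sum-nonneg {zero}  f 0≤f = ℤₚ.≤-refl
  sum-nonneg {suc n} f 0≤f = ℤₚ.+-mono-≤ (0≤f zero) (sum-nonneg (f ∘ suc) (0≤f ∘ suc))

  nonneg-sum≡0 : ∀ {a b} → + 0 ℤ.≤ a → + 0 ℤ.≤ b → a ℤ.+ b ≡ + 0 → a ≡ + 0 × b ≡ + 0
  nonneg-sum≡0 {+ zero} {+ zero} _ _ _ = ≡.refl , ≡.refl

  sum≡0⇒zero : ∀ {n} (f : Fin n → ℤ) → (∀ i → + 0 ℤ.≤ f i) → sum f ≡ + 0 → ∀ i → f i ≡ + 0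
  sum≡0⇒zero {suc n} f 0≤f Σ≡0 i
    with nonneg-sum≡0 (0≤f zero) (sum-nonneg (f ∘ suc) (0≤f ∘ suc)) Σ≡0
  sum≡0⇒zero f 0≤f Σ≡0 zero    | f₀≡0 , _    = f₀≡0
  sum≡0⇒zero f 0≤f Σ≡0 (suc i) | _    , Σ₊≡0 = sum≡0⇒zero (f ∘ suc) (0≤f ∘ suc) Σ₊≡0 i


-- The skew matrix S, its square N and the defect Q

module RegularTournament {m : ℕ} (T : Tournament m) (regular : Regular T) where
  open ℤSum
  open +-*-Solver
  open ≡.≡-Reasoning

  -- As a difference of indicators, its row sums are out-degree minus in-degree.
  S : Fin m → Fin m → ℤ
  S u v = + indicator (arc T u v) ℤ.- + indicator (arc T v u)

  S-skew : ∀ u v → S v u ≡ ℤ.- S u v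
  S-skew u v = solve 2 (λ a b → b :- a := :- (a :- b))
       ≡.refl (+ indicator (arc T u v)) (+ indicator (arc T v u))

  S-diagonal : ∀ u → S u u ≡ + 0
  S-diagonal u = ℤₚ.+-inverseʳ (+ indicator (arc T u u))

  S-offDiagonal : ∀ {u v} → u ≢ v → S u v ≡ + 1 ⊎ S u v ≡ ℤ.- (+ 1)
  S-offDiagonal {u} {v} u≢v rewrite oriented T u v u≢v with arc T u v
  ... | true  = inj₁ ≡.refl
  ... | false = inj₂ ≡.refl

  S-rowSum : ∀ u → sum (S u) ≡ + 0
  S-rowSum u = begin
    sum (S u)
      ≡⟨ ∑-distrib-+ (λ v → + indicator (arc T u v)) (λ v → ℤ.- (+ indicator (arc T v u))) ⟩
    sum (λ v → + indicator (arc T u v)) ℤ.+ sum (λ v → ℤ.- (+ indicator (arc T v u)))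
      ≡⟨ ≡.cong₂ ℤ._+_ (sum-pos (λ v → indicator (arc T u v)))
           (≡.trans (sum-neg (λ v → + indicator (arc T v u)))
             (≡.cong ℤ.-_ (sum-pos (λ v → indicator (arc T v u))))) ⟩
    + outdeg T u ℤ.- + indeg T u
      ≡⟨ ≡.cong₂ (λ a b → + a ℤ.- + b) (proj₁ (proj₂ regular u)) (proj₂ (proj₂ regular u)) ⟩
    + proj₁ regular ℤ.- + proj₁ regular
      ≡⟨ ℤₚ.+-inverseʳ (+ proj₁ regular) ⟩
    + 0 ∎
    where
    sum-pos : ∀ {n} (f : Fin n → ℕ) → sum (λ i → + f i) ≡ + sumℕ n f
    sum-pos {zero}  f = ≡.refl
    sum-pos {suc n} f = ≡.cong (ℤ._+_ (+ f zero)) (sum-pos (f ∘ suc))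

  S-squares : ∀ u k → S u k ℤ.* S k u ≡ δ u k ℤ.+ -[1+ 0 ]
  S-squares u k with u ≟ k
  ... | yes ≡.refl = ≡.cong₂ ℤ._*_ (S-diagonal u) (S-diagonal u)
  ... | no u≢k = ≡.trans (≡.cong (S u k ℤ.*_) (S-skew u k)) (units (S-offDiagonal u≢k))
    where
    units : ∀ {s} → s ≡ + 1 ⊎ s ≡ ℤ.- (+ 1) → s ℤ.* ℤ.- s ≡ -[1+ 0 ]
    units (inj₁ ≡.refl) = ≡.refl
    units (inj₂ ≡.refl) = ≡.refl

  N : Fin m → Fin m → ℤ
  N u v = sum (λ k → S u k ℤ.* S k v)

  N-diagonal : ∀ u → N u u ≡ + 1 ℤ.- + m
  N-diagonal u = begin
    N u u                                    ≡⟨ sum-cong-≗ (S-squares u) ⟩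
    sum (λ k → δ u k ℤ.+ -[1+ 0 ])           ≡⟨ ∑-distrib-+ (δ u) (λ _ → -[1+ 0 ]) ⟩
    sum (δ u) ℤ.+ sum {m} (λ _ → -[1+ 0 ])   ≡⟨ ≡.cong₂ ℤ._+_ (sum-δ-one u) (sum-const m -[1+ 0 ]) ⟩
    + 1 ℤ.+ + m ℤ.* -[1+ 0 ]
      ≡⟨ solve 1 (λ m → con (+ 1) :+ m :* con -[1+ 0 ] := con (+ 1) :- m) ≡.refl (+ m) ⟩
    + 1 ℤ.- + m                              ∎

  Q : Fin m → Fin m → ℤ
  Q u v = N u v ℤ.+ (+ m ℤ.* δ u v ℤ.+ -[1+ 0 ])

  Q-diagonal : ∀ u → Q u u ≡ + 0
  Q-diagonal u = ≡.trans
    (≡.cong₂ (λ a d → a ℤ.+ (+ m ℤ.* d ℤ.+ -[1+ 0 ])) (N-diagonal u) (δ-diagonal u))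
    (solve 1 (λ m → con (+ 1) :- m :+ (m :* con (+ 1) :+ con -[1+ 0 ]) := con (+ 0)) ≡.refl (+ m))

  Q-symmetric : ∀ u v → Q u v ≡ Q v u
  Q-symmetric u v = ≡.cong₂ (λ a d → a ℤ.+ (+ m ℤ.* d ℤ.+ -[1+ 0 ]))
    (sum-cong-≗ (λ k → ≡.trans (≡.cong₂ ℤ._*_ (S-skew k u) (S-skew v k))
      (solve 2 (λ a b → :- a :* :- b := b :* a) ≡.refl (S k u) (S v k))))
    (δ-symmetric u v)

  Q-rowSum : ∀ u → sum (Q u) ≡ + 0
  Q-rowSum u = begin
    sum (Q u)
      ≡⟨ ∑-distrib-+ (N u) (λ v → + m ℤ.* δ u v ℤ.+ -[1+ 0 ]) ⟩
    sum (N u) ℤ.+ sum (λ v → + m ℤ.* δ u v ℤ.+ -[1+ 0 ])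
      ≡⟨ ≡.cong₂ ℤ._+_ N-rowSum (∑-distrib-+ (λ v → + m ℤ.* δ u v) (λ _ → -[1+ 0 ])) ⟩
    + 0 ℤ.+ (sum (λ v → + m ℤ.* δ u v) ℤ.+ sum {m} (λ _ → -[1+ 0 ]))
      ≡⟨ ≡.cong₂ (λ a b → + 0 ℤ.+ (a ℤ.+ b))
           (≡.trans (≡.sym (*-distribˡ-sum (+ m) (δ u))) (≡.cong (+ m ℤ.*_) (sum-δ-one u)))
                (sum-const m -[1+ 0 ]) ⟩
    + 0 ℤ.+ (+ m ℤ.* + 1 ℤ.+ + m ℤ.* -[1+ 0 ])
      ≡⟨ solve 1 (λ m → con (+ 0) :+ (m :* con (+ 1) :+ m :* con -[1+ 0 ]) := con (+ 0)) ≡.refl (+ m) ⟩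
    + 0 ∎
    where
    N-rowSum : sum (N u) ≡ + 0
    N-rowSum = begin
      sum (λ v → sum (λ k → S u k ℤ.* S k v))  ≡⟨ ∑-comm (λ v k → S u k ℤ.* S k v) ⟩
      sum (λ k → sum (λ v → S u k ℤ.* S k v))  ≡⟨ sum-cong-≗ (λ k → ≡.sym (*-distribˡ-sum (S u k) (S k))) ⟩
      sum (λ k → S u k ℤ.* sum (S k))
        ≡⟨ sum-cong-≗ (λ k → ≡.trans (≡.cong (S u k ℤ.*_) (S-rowSum k)) (ℤₚ.*-zeroʳ (S u k))) ⟩
      sum {m} (λ _ → + 0)                      ≡⟨ sum-replicate-zero m ⟩
      + 0                                      ∎

  -- The bordered matrix

  bordered : Fin (suc m) → Fin (suc m) → ℤ
  bordered zero    _       = + 1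
  bordered (suc i) zero    = ℤ.- (+ 1)
  bordered (suc i) (suc j) = δ i j ℤ.+ S i j

  δ+S-rowSum : ∀ i → sum (λ k → δ i k ℤ.+ S i k) ≡ + 1
  δ+S-rowSum i = ≡.trans (∑-distrib-+ (δ i) (S i)) (≡.cong₂ ℤ._+_ (sum-δ-one i) (S-rowSum i))

  -- By skewness (I + S)(I + S)ᵀ = (I + S)(I - S) = I - S².
  δ+S-rows : ∀ i j → sum (λ k → (δ i k ℤ.+ S i k) ℤ.* (δ j k ℤ.+ S j k)) ≡ δ j i ℤ.- N i j
  δ+S-rows i j = begin
    sum (λ k → (δ i k ℤ.+ S i k) ℤ.* (δ j k ℤ.+ S j k))
      ≡⟨ sum-cong-≗ (λ k → ≡.trans
           (solve 4 (λ d s e t → (d :+ s) :* (e :+ t) := d :* (e :+ t) :+ (e :* s :+ s :* t))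
                ≡.refl (δ i k) (S i k) (δ j k) (S j k))
           (≡.cong (λ t → δ i k ℤ.* (δ j k ℤ.+ S j k) ℤ.+ (δ j k ℤ.* S i k ℤ.+ t))
             (≡.trans (≡.cong (S i k ℤ.*_) (S-skew k j)) (≡.sym (ℤₚ.neg-distribʳ-* (S i k) (S k j)))))) ⟩
    sum (λ k → δ i k ℤ.* (δ j k ℤ.+ S j k) ℤ.+ (δ j k ℤ.* S i k ℤ.+ ℤ.- (S i k ℤ.* S k j)))
      ≡⟨ ∑-distrib-+ (λ k → δ i k ℤ.* (δ j k ℤ.+ S j k)) (λ k → δ j k ℤ.* S i k ℤ.+ ℤ.- (S i k ℤ.* S k j)) ⟩
    sum (λ k → δ i k ℤ.* (δ j k ℤ.+ S j k)) ℤ.+ sum (λ k → δ j k ℤ.* S i k ℤ.+ ℤ.- (S i k ℤ.* S k j))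
      ≡⟨ ≡.cong₂ ℤ._+_ (sum-δ i (λ k → δ j k ℤ.+ S j k))
           (≡.trans (∑-distrib-+ (λ k → δ j k ℤ.* S i k) (λ k → ℤ.- (S i k ℤ.* S k j)))
             (≡.cong₂ ℤ._+_ (sum-δ j (S i)) (sum-neg (λ k → S i k ℤ.* S k j)))) ⟩
    (δ j i ℤ.+ S j i) ℤ.+ (S i j ℤ.- N i j)
      ≡⟨ ≡.cong (λ t → (δ j i ℤ.+ t) ℤ.+ (S i j ℤ.- N i j)) (S-skew i j) ⟩
    (δ j i ℤ.- S i j) ℤ.+ (S i j ℤ.- N i j)
      ≡⟨ solve 3 (λ d s n → (d :- s) :+ (s :- n) := d :- n) ≡.refl (δ j i) (S i j) (N i j) ⟩
    δ j i ℤ.- N i j ∎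

  bordered-unit : ∀ i j → bordered i j ≡ + 1 ⊎ bordered i j ≡ ℤ.- (+ 1)
  bordered-unit zero    j       = inj₁ ≡.refl
  bordered-unit (suc i) zero    = inj₂ ≡.refl
  bordered-unit (suc i) (suc j) with i ≟ j
  ... | yes ≡.refl = inj₁ (≡.cong (ℤ._+_ (+ 1)) (S-diagonal i))
  ... | no i≢j with S-offDiagonal i≢j
  ...   | inj₁ s≡1  = inj₁ (≡.trans (ℤₚ.+-identityˡ _) s≡1)
  ...   | inj₂ s≡-1 = inj₂ (≡.trans (ℤₚ.+-identityˡ _) s≡-1)

  bordered-skew : ∀ i j → bordered i j ℤ.- δ i j ≡ ℤ.- (bordered j i ℤ.- δ j i)
  bordered-skew zero    zero    = ≡.refl
  bordered-skew zero    (suc j) = ≡.refl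
  bordered-skew (suc i) zero    = ≡.refl
  bordered-skew (suc i) (suc j) = ≡.trans
    (≡.cong (λ t → δ i j ℤ.+ t ℤ.- δ i j) (S-skew j i))
    (solve 3 (λ d e s → d :+ :- s :- d := :- (e :+ s :- e)) ≡.refl (δ i j) (δ j i) (S j i))

  -- The border adds J to the block I - S², which makes it (m + 1) I - Q. Against the first row, the
  -- border entry -1 cancels the row sum 1 of I + S.
  bordered-rows : (∀ u v → Q u v ≡ + 0) → ∀ i j →
    sum (λ k → bordered i k ℤ.* bordered j k) ≡ + suc m ℤ.* δ i j
  bordered-rows Q≡0 zero zero = sum-const (suc m) (+ 1)
  bordered-rows Q≡0 zero (suc j) = ≡.trans
    (≡.cong (ℤ._+_ -[1+ 0 ]) (≡.trans (sum-cong-≗ (λ k → ℤₚ.*-identityˡ (δ j k ℤ.+ S j k))) (δ+S-rowSum j)))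
    (≡.sym (ℤₚ.*-zeroʳ (+ suc m)))
  bordered-rows Q≡0 (suc i) zero = ≡.trans
    (≡.cong (ℤ._+_ -[1+ 0 ]) (≡.trans (sum-cong-≗ (λ k → ℤₚ.*-identityʳ (δ i k ℤ.+ S i k))) (δ+S-rowSum i)))
    (≡.sym (ℤₚ.*-zeroʳ (+ suc m)))
  bordered-rows Q≡0 (suc i) (suc j) = begin
    + 1 ℤ.+ sum (λ k → (δ i k ℤ.+ S i k) ℤ.* (δ j k ℤ.+ S j k))
      ≡⟨ ≡.cong (ℤ._+_ (+ 1)) (≡.trans (δ+S-rows i j) (≡.cong (ℤ._- N i j) (δ-symmetric j i))) ⟩
    + 1 ℤ.+ (δ i j ℤ.- N i j)
      ≡⟨ solve 3 (λ m d n → con (+ 1) :+ (d :- n) := (con (+ 1) :+ m) :* d :- (n :+ (m :* d :+ con -[1+ 0 ])))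
           ≡.refl (+ m) (δ i j) (N i j) ⟩
    + suc m ℤ.* δ i j ℤ.- Q i j
      ≡⟨ ≡.trans (≡.cong (λ q → + suc m ℤ.* δ i j ℤ.- q) (Q≡0 i j)) (ℤₚ.+-identityʳ _) ⟩
    + suc m ℤ.* δ i j ∎

  skewHadamard : (∀ u v → Q u v ≡ + 0) → SkewHadamardExists (suc m)
  skewHadamard Q≡0 = bordered
    , (bordered-unit , λ i j → ≡.trans (sumℤ≡sum (λ k → bordered i k ℤ.* bordered j k))
         (bordered-rows Q≡0 i j))
    , bordered-skew

  -- By symmetry of `Q` the trace of its square is the sum of the squares of its entries.
  trace-square≡0⇒Q≡0 : sum (λ u → sum (λ v → Q u v ℤ.* Q v u)) ≡ + 0 → ∀ u v → Q u v ≡ + 0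
  trace-square≡0⇒Q≡0 tr≡0 u v = square≡0 (sum≡0⇒zero (λ v → Q u v ℤ.* Q u v) (λ v → 0≤i*i (Q u v))
    (sum≡0⇒zero (λ u → sum (λ v → Q u v ℤ.* Q u v)) (λ u → sum-nonneg _ (λ v → 0≤i*i (Q u v)))
      (≡.trans (sum-cong-≗ (λ u → sum-cong-≗ (λ v → ≡.cong (Q u v ℤ.*_) (Q-symmetric u v)))) tr≡0) u) v)
    where
    square≡0 : ∀ {i} → i ℤ.* i ≡ + 0 → i ≡ + 0
    square≡0 {i} e with ℤₚ.i*j≡0⇒i≡0∨j≡0 i e
    ... | inj₁ p = p
    ... | inj₂ p = p

-- The order n + 1 divides both 3n and 3(n + 1), hence it divides 3.
small-order : ∀ n j → 3 ℕ.* n ≡ j ℕ.* suc n → n ≡ 0 ⊎ n ≡ 2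
small-order n j e = cases n (∣m+n∣m⇒∣n (≡.subst (suc n ∣_)
     (≡.trans (ℕₚ.*-suc 3 n) (ℕₚ.+-comm 3 (3 ℕ.* n))) (n∣m*n 3))
    (divides j e))
  where
  cases : ∀ n → suc n ∣ 3 → n ≡ 0 ⊎ n ≡ 2
  cases 0 _ = inj₁ ≡.refl
  cases 1 d = ⊥-elim (from-no (2 ∣? 3) d)
  cases 2 _ = inj₂ ≡.refl
  cases (suc (suc (suc n))) d with ∣⇒≤ d
  ... | ℕ.s≤s (ℕ.s≤s (ℕ.s≤s ()))

-- Orders one and three

module _ (T : Tournament 1) (regular : Regular T) where
  open RegularTournament T regular

  Q≡0-order1 : ∀ u v → Q u v ≡ + 0
  Q≡0-order1 zero zero = Q-diagonal zero

module _ (T : Tournament 3) (regular : Regular T) where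
  open RegularTournament T regular
  open +-*-Solver
  open ≡.≡-Reasoning

  private
    a = Q zero (suc zero)
    b = Q zero (suc (suc zero))
    c = Q (suc zero) (suc (suc zero))

    a+b≡0 : a ℤ.+ b ≡ + 0
    a+b≡0 = begin
      a ℤ.+ b
        ≡⟨ solve 2 (λ a b → a :+ b := con (+ 0) :+ (a :+ (b :+ con (+ 0)))) ≡.refl a b ⟩
      + 0 ℤ.+ (a ℤ.+ (b ℤ.+ + 0))            ≡⟨ ≡.cong (ℤ._+ (a ℤ.+ (b ℤ.+ + 0))) (Q-diagonal zero) ⟨
      ℤSum.sum (Q zero)                      ≡⟨ Q-rowSum zero ⟩
      + 0                                    ∎

    a+c≡0 : a ℤ.+ c ≡ + 0
    a+c≡0 = begin
      a ℤ.+ c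
        ≡⟨ solve 2 (λ a b → a :+ b := a :+ (con (+ 0) :+ (b :+ con (+ 0)))) ≡.refl a c ⟩
      a ℤ.+ (+ 0 ℤ.+ (c ℤ.+ + 0))
        ≡⟨ ≡.cong₂ (λ x y → x ℤ.+ (y ℤ.+ (c ℤ.+ + 0))) (Q-symmetric (suc zero) zero) (Q-diagonal (suc zero)) ⟨
      ℤSum.sum (Q (suc zero))                ≡⟨ Q-rowSum (suc zero) ⟩
      + 0                                    ∎

    b+c≡0 : b ℤ.+ c ≡ + 0
    b+c≡0 = begin
      b ℤ.+ c
        ≡⟨ solve 2 (λ a b → a :+ b := a :+ (b :+ (con (+ 0) :+ con (+ 0)))) ≡.refl b c ⟩
      b ℤ.+ (c ℤ.+ (+ 0 ℤ.+ + 0))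
        ≡⟨ ≡.cong₂ (λ x y → x ℤ.+ y) (Q-symmetric (suc (suc zero)) zero)
             (≡.cong₂ (λ x y → x ℤ.+ (y ℤ.+ + 0)) (Q-symmetric (suc (suc zero)) (suc zero))
               (Q-diagonal (suc (suc zero)))) ⟨
      ℤSum.sum (Q (suc (suc zero)))          ≡⟨ Q-rowSum (suc (suc zero)) ⟩
      + 0                                    ∎

    pairwise : ∀ {x y z} → x ℤ.+ y ≡ + 0 → x ℤ.+ z ≡ + 0 → y ℤ.+ z ≡ + 0 → x ≡ + 0
    pairwise {x} {y} {z} xy xz yz = ℤₚ.*-cancelˡ-≡ (+ 2) x (+ 0) (begin
      + 2 ℤ.* x
        ≡⟨ solve 3 (λ x y z → con (+ 2) :* x := (x :+ y) :+ (x :+ z) :- (y :+ z)) ≡.refl x y z ⟩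
      (x ℤ.+ y) ℤ.+ (x ℤ.+ z) ℤ.- (y ℤ.+ z)      ≡⟨ ≡.cong₂ ℤ._-_ (≡.cong₂ ℤ._+_ xy xz) yz ⟩
      + 2 ℤ.* + 0                                ∎)

    a≡0 : a ≡ + 0
    a≡0 = pairwise a+b≡0 a+c≡0 b+c≡0

    b≡0 : b ≡ + 0
    b≡0 = ≡.trans (≡.sym (ℤₚ.+-identityˡ b)) (≡.trans (≡.cong (ℤ._+ b) (≡.sym a≡0)) a+b≡0)

    c≡0 : c ≡ + 0
    c≡0 = ≡.trans (≡.sym (ℤₚ.+-identityˡ c)) (≡.trans (≡.cong (ℤ._+ c) (≡.sym a≡0)) a+c≡0)

  -- Symmetry and the zero diagonal leave three entries; the row sums say that any two of them add
  -- up to 0.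
  Q≡0-order3 : ∀ u v → Q u v ≡ + 0
  Q≡0-order3 zero             zero             = Q-diagonal zero
  Q≡0-order3 zero             (suc zero)       = a≡0
  Q≡0-order3 zero             (suc (suc zero)) = b≡0
  Q≡0-order3 (suc zero)       zero             = ≡.trans (Q-symmetric (suc zero) zero) a≡0
  Q≡0-order3 (suc zero)       (suc zero)       = Q-diagonal (suc zero)
  Q≡0-order3 (suc zero)       (suc (suc zero)) = c≡0
  Q≡0-order3 (suc (suc zero)) zero             = ≡.trans (Q-symmetric (suc (suc zero)) zero) b≡0
  Q≡0-order3 (suc (suc zero)) (suc zero)       = ≡.trans (Q-symmetric (suc (suc zero)) (suc zero)) c≡0
  Q≡0-order3 (suc (suc zero)) (suc (suc zero)) = Q-diagonal (suc (suc zero))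

-- Transfer between the integers and the field

module _ {c ℓ : Level} (K : ACField c ℓ) where
  open Field K
  open LinearAlgebra K
  open SkewSpectrum K

  sumK≈sum : ∀ {n} (f : Fin n → Carrier) → Spectrum.sumK K n f ≈ sum f
  sumK≈sum {zero}  f = refl
  sumK≈sum {suc n} f = +-congˡ (sumK≈sum (f ∘ suc))

  ι-sum : ∀ {n} (f : Fin n → ℤ) → ι (ℤSum.sum f) ≈ sum (ι ∘ f)
  ι-sum {zero}  f = refl
  ι-sum {suc n} f = trans (ι-+ (f zero) (ℤSum.sum (f ∘ suc))) (+-congˡ (ι-sum (f ∘ suc)))

  ι-injective : ∀ {i j} → ι i ≈ ι j → i ≡ j
  ι-injective {i} {j} e = ℤₚ.i-j≡0⇒i≡j i j (ι-injective-0 (i ℤ.- j)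
    (trans (ι-+ i (ℤ.- j)) (trans (+-congˡ (ι-neg j)) (x≈y⇒x-y≈0 e))))

  module _ (ω : Carrier) (isω : Spectrum.IsOmega K ω) {n : ℕ} (T : Tournament (suc n))
    (regular : Regular T) where
    open RegularTournament T regular using (S; S-skew; S-diagonal; S-rowSum; N; N-diagonal; Q; Q-diagonal;
      trace-square≡0⇒Q≡0)

    D H : Matrix (suc n) (suc n)
    D u v = ι (S u v)
    H     = Spectrum.Hω K ω T

    s : Carrier
    s = two * ω - 1#

    ss≈-3 : s * s ≈ - three
    ss≈-3 = begin
      s * s
        ≈⟨ solve 1 (λ w → (con (+ 2) :* w :- con (+ 1)) :* (con (+ 2) :* w :- con (+ 1))
             := con (+ 4) :* (w :* w :- w :+ con (+ 1)) :- con (+ 3)) refl ω ⟩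
      ι (+ 4) * (ω * ω - ω + 1#) - three
        ≈⟨ +-congʳ (trans (*-congˡ isω) (zeroʳ (ι (+ 4)))) ⟩
      0# - three
        ≈⟨ +-identityˡ _ ⟩
      - three ∎

    D-skew : ∀ u v → D v u ≈ - D u v
    D-skew u v = trans (reflexive (≡.cong ι (S-skew u v))) (ι-neg (S u v))

    D-rowSum : ∀ u → sum (D u) ≈ 0#
    D-rowSum u = trans (sym (ι-sum (S u))) (reflexive (≡.cong ι (S-rowSum u)))

    -- Because ω = (1 + s)/2 and its conjugate is (1 - s)/2.
    2H≈ : ∀ u v → two * H u v ≈ s * D u v + (1# - identity u v)
    2H≈ u v with u ≟ v
    ... | yes ≡.refl = begin
      two * 0#
        ≈⟨ solve 1 (λ s → con (+ 2) :* con (+ 0) := s :* con (+ 0) :+ (con (+ 1) :- con (+ 1))) refl s ⟩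
      s * 0# + (1# - 1#)          ≈⟨ +-congʳ (*-congˡ (reflexive (≡.cong ι (S-diagonal u)))) ⟨
      s * D u u + (1# - 1#)       ∎
    ... | no u≢v rewrite oriented T u v u≢v with arc T u v
    ...   | true  = solve 1 (λ w → con (+ 2) :* w
         := (con (+ 2) :* w :- con (+ 1)) :* con (+ 1) :+ (con (+ 1) :- con (+ 0))) refl ω
    ...   | false = solve 1 (λ w → con (+ 2) :* (con (+ 1) :- w)
                      := (con (+ 2) :* w :- con (+ 1)) :* con -[1+ 0 ] :+ (con (+ 1) :- con (+ 0))) refl ω

    open Skew D H s ss≈-3 D-skew D-rowSum 2H≈

    eigenvalue : ∀ {μ} → Spectrum.IsEigenvalue K ω T μ → Eigenvalue H μ
    eigenvalue (x , x≉0 , Hx≈μx) = x , x≉0 , λ u → trans (sym (sumK≈sum (λ v → H u v * x v))) (Hx≈μx u)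

    isEigenvalue : ∀ {μ} → Eigenvalue H μ → Spectrum.IsEigenvalue K ω T μ
    isEigenvalue (x , x≉0 , Hx≈μx) = x , x≉0 , λ u → trans (sumK≈sum (λ v → H u v * x v)) (Hx≈μx u)

    ι-⊗ : ∀ (A B : Fin (suc n) → Fin (suc n) → ℤ) {A′ B′ : Matrix (suc n) (suc n)} →
      (∀ u v → ι (A u v) ≈ A′ u v) → (∀ u v → ι (B u v) ≈ B′ u v) →
      ∀ u v → ι (ℤSum.sum (λ k → A u k ℤ.* B k v)) ≈ (A′ ⊗ B′) u v
    ι-⊗ A B A≈ B≈ u v = trans (ι-sum (λ k → A u k ℤ.* B k v))
      (sum-cong (λ k → trans (ι-* (A u k) (B k v)) (*-cong (A≈ u k) (B≈ k v))))

    ι-N : ∀ u v → ι (N u v) ≈ (D ⊗ D) u v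
    ι-N = ι-⊗ S S (λ _ _ → refl) (λ _ _ → refl)

    ι-Q : ∀ u v → ι (Q u v) ≈ defect u v
    ι-Q u v = trans (ι-+ (N u v) (+ suc n ℤ.* δ u v ℤ.+ -[1+ 0 ]))
      (+-cong (ι-N u v) (trans (ι-+ (+ suc n ℤ.* δ u v) -[1+ 0 ]) (+-congʳ (ι-* (+ suc n) (δ u v)))))

    trace-defect≈0 : trace defect ≈ 0#
    trace-defect≈0 = sum-zero (λ u → trans (sym (ι-Q u u)) (reflexive (≡.cong ι (Q-diagonal u))))

    -- Each of the n + 1 diagonal entries of S² is 1 - (n + 1) = -n.
    trace-gram≈ : trace gram ≈ ι (+ suc n ℤ.* + (3 ℕ.* n))
    trace-gram≈ = begin
      trace gram
        ≈⟨ sum-cong (λ u → *-congˡ {x = - three} (trans (sym (ι-N u u))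
             (reflexive (≡.cong ι (N-diagonal u))))) ⟩
      sum {suc n} (λ _ → - three * ι (+ 1 ℤ.- + suc n)) ≈⟨ sum-const (suc n) _ ⟩
      m * (- three * ι (+ 1 ℤ.- + suc n))     ≈⟨ *-congˡ (ι-* (ℤ.- (+ 3)) (+ 1 ℤ.- + suc n)) ⟨
      m * ι (ℤ.- (+ 3) ℤ.* (+ 1 ℤ.- + suc n)) ≡⟨ ≡.cong (λ i → m * ι i) (≡.trans
        (+-*-Solver.solve 1 (λ n → con′ (ℤ.- (+ 3)) :*′ (con′ (+ 1) :-′ (con′ (+ 1) :+′ n))
           :=′ con′ (+ 3) :*′ n) ≡.refl (+ n))
        (≡.sym (ℤₚ.pos-* 3 n))) ⟩
      m * ι (+ (3 ℕ.* n))                     ≈⟨ ι-* (+ suc n) (+ (3 ℕ.* n)) ⟨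
      ι (+ suc n ℤ.* + (3 ℕ.* n))             ∎
      where
      open +-*-Solver using ()
        renaming (con to con′; _:*_ to _:*′_; _:+_ to _:+′_; _:-_ to _:-′_; _:=_ to _:=′_)

    -- Both sides of 3 m n = j m² are images of integers, where the nonzero factor m cancels.
    order-of-gram : ∀ j → trace gram ≈ nat j * (m * m) → 3 ℕ.* n ≡ j ℕ.* suc n
    order-of-gram j e = ℤₚ.+-injective (≡.trans (ℤₚ.*-cancelˡ-≡ (+ suc n) (+ (3 ℕ.* n)) (+ j ℤ.* + suc n)
      (ι-injective (begin
        ι (+ suc n ℤ.* + (3 ℕ.* n))          ≈⟨ trace-gram≈ ⟨
        trace gram                           ≈⟨ e ⟩
        nat j * (m * m)
          ≈⟨ solve 2 (λ j m → j :* (m :* m) := m :* (j :* m)) refl (nat j) m ⟩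
        m * (nat j * m)                      ≈⟨ *-congˡ (ι-* (+ j) (+ suc n)) ⟨
        m * ι (+ j ℤ.* + suc n)              ≈⟨ ι-* (+ suc n) (+ j ℤ.* + suc n) ⟨
        ι (+ suc n ℤ.* (+ j ℤ.* + suc n))    ∎))) (≡.sym (ℤₚ.pos-* j (suc n))))

    Q≡0 : Spectrum.ExactlyThreeEigenvalues K ω T → ∀ u v → Q u v ≡ + 0
    Q≡0 (_ , _ , _ , l₁≉l₂ , l₁≉l₃ , l₂≉l₃ , e₁ , e₂ , e₃ , spec) u v = decidable-stable (Q u v ℤ.≟ + 0)
      (trace-dichotomy l₁≉l₂ l₁≉l₃ l₂≉l₃ (eigenvalue e₁) (eigenvalue e₂) (eigenvalue e₃)
        (λ h e → spec h (isEigenvalue e)) trace-defect≈0 >>= λ outcome → pure (conclude outcome u v))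
      where
      conclude : (∃ λ j → trace gram ≈ nat j * (m * m)) ⊎ m - 1# ≈ 0# ⊎ trace (defect ⊗ defect) ≈ 0# →
                 ∀ u v → Q u v ≡ + 0
      conclude (inj₁ (j , e)) with small-order n j (order-of-gram j e)
      ... | inj₁ ≡.refl = Q≡0-order1 T regular
      ... | inj₂ ≡.refl = Q≡0-order3 T regular
      conclude (inj₂ (inj₁ m≈1)) with ℤₚ.+-injective (ι-injective {+ suc n} {+ 1} (x-y≈0⇒x≈y m≈1))
      ... | ≡.refl = Q≡0-order1 T regular
      conclude (inj₂ (inj₂ tr≈0)) = trace-square≡0⇒Q≡0 (ι-injective (trans
        (trans (ι-sum (λ u → ℤSum.sum (λ v → Q u v ℤ.* Q v u))) (sum-cong (λ u → ι-⊗ Q Q ι-Q ι-Q u u))) tr≈0))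

theorem3p2 : ∀ {c ℓ : Level} (K : ACField c ℓ)
    (ω : CommutativeRing.Carrier (ACField.ring K)) →
    Spectrum.IsOmega K ω →
    (m : ℕ) (T : Tournament m) → Regular T →
    Spectrum.ExactlyThreeEigenvalues K ω T →
    SkewHadamardExists (suc m)
-- In order 0 an eigenvector would need a nonzero coordinate, and there are no coordinates.
theorem3p2 K ω isω zero T regular (_ , _ , _ , _ , _ , _ , (_ , (() , _) , _) , _)
theorem3p2 K ω isω (suc n) T regular three =
  RegularTournament.skewHadamard T regular (Q≡0 K ω isω T regular three)
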